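{- Let $k\geq 2$ and let \[ y_{k}=\frac{1-(k-2)x-\sqrt{(1-kx)^{2}-4x^{2}}}{2x(1-(k-2)x)}, \] where the square root is the formal power series in $x$ with constant term $1$ (so that $y_k$ is a formal power series in $x$). For integers $0\le i<j$ put $\beta_{i,j}=jx\prod_{s=i+1}^{j-1}(sx-1)$ (an empty product equals $1$), and put $\beta_{j,j}=1$. Then the ordinary generating function for the number of $(k,2)$-noncrossing partitions of $[n]$ is \[ \sum_{n\geq 0}\#\mathcal{P}_{k}(n)x^{n}=\frac{\frac{x^{k-1}y_{k}}{1-xy_{k}}+\sum_{j=0}^{k-2}\sum_{i=0}^{j}(-1)^{i+j}x^{i}\beta _{i,j}}{1-\sum_{j=0}^{k-2}\sum_{i=0}^{j}(-1)^{i+j}ix\beta _{i,j}}, \] where $\mathcal{P}_k(n)$ denotes the set of $(k,2)$-noncrossing partitions of $[n]=\{1,\dots,n\}$.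
   Context: A set partition of $[n]$ is identified with its canonical sequential form $\pi_1\pi_2\cdots\pi_n$: list the blocks $B_1,\dots,B_d$ in increasing order of their minimum elements and set $\pi_i=m$ iff $i\in B_m$ (the empty word is the unique partition of $[0]$). The reduced form of a word over letters $a_1<\dots<a_d$ is obtained by renaming $a_i$ as $i$. A partition $\pi$ avoids a word $\tau$ if no subsequence $\pi_{i_1}\cdots\pi_{i_m}$ ($i_1<\dots<i_m$) has the same reduced form as $\tau$. A partition is $(k,d)$-noncrossing if it avoids $12\cdots k12\cdots d$; in particular $(k,2)$-noncrossing means avoiding $12\cdots k12$. -}

module Defs where

open import Data.Bool using (Bool; true; false; _∧_; not)
open import Data.Nat as ℕ using (ℕ; zero; suc; _⊔_; _∸_; _≤ᵇ_)
open import Data.Integer as ℤ using (ℤ; +_; -_)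
open import Data.List using (List; []; _∷_; _++_; map; concatMap; upTo; filterᵇ; length; deduplicate; foldr)
open import Data.List.Properties using (≡-dec)
open import Relation.Nullary.Decidable using (⌊_⌋)
open import Relation.Binary.PropositionalEquality using (_≡_)

sublists : List ℕ → List (List ℕ)
sublists []       = [] ∷ []
sublists (a ∷ w)  = map (a ∷_) (sublists w) ++ sublists w

reduce : List ℕ → List ℕ
reduce w = map (λ a → suc (length (deduplicate ℕ._≟_ (filterᵇ (λ b → suc b ≤ᵇ a) w)))) w

_==ᴸ_ : List ℕ → List ℕ → Bool
u ==ᴸ v = ⌊ ≡-dec ℕ._≟_ u v ⌋

avoids : List ℕ → List ℕ → Bool
avoids π τ = foldr (λ s r → not (reduce s ==ᴸ reduce τ) ∧ r) true (sublists π)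

pattern-k12 : ℕ → List ℕ
pattern-k12 k = map suc (upTo k) ++ (1 ∷ 2 ∷ [])

-- canonical sequential form: π₁ = 1 and π_i ≤ 1 + max(π₁,…,π_{i-1}), letters ≥ 1
isCanonical′ : ℕ → List ℕ → Bool
isCanonical′ m []      = true
isCanonical′ m (a ∷ w) = (1 ≤ᵇ a) ∧ (a ≤ᵇ suc m) ∧ isCanonical′ (m ⊔ a) w

isCanonical : List ℕ → Bool
isCanonical = isCanonical′ 0

words : ℕ → ℕ → List (List ℕ)
words zero    m = [] ∷ []
words (suc n) m = concatMap (λ a → map (a ∷_) (words n m)) (map suc (upTo m))

-- the set partitions of [n] (canonical forms), as a list without repetitions
partitions : ℕ → List (List ℕ)
partitions n = filterᵇ isCanonical (words n n)

countP : ℕ → ℕ → ℕ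
countP k n = length (filterᵇ (λ π → avoids π (pattern-k12 k)) (partitions n))

PS : Set
PS = ℕ → ℤ

_≈_ : PS → PS → Set
f ≈ g = ∀ n → f n ≡ g n
infix 4 _≈_

sumℤ : List ℤ → ℤ
sumℤ = foldr ℤ._+_ (+ 0)

const : ℤ → PS
const c zero    = c
const c (suc n) = + 0

X : PS
X zero          = + 0
X (suc zero)    = + 1
X (suc (suc n)) = + 0

_⊕_ : PS → PS → PS
(f ⊕ g) n = f n ℤ.+ g n

⊖_ : PS → PS
(⊖ f) n = - f n

_⊝_ : PS → PS → PS
f ⊝ g = f ⊕ (⊖ g)

_⊛_ : PS → PS → PS
(f ⊛ g) n = sumℤ (map (λ i → f i ℤ.* g (n ∸ i)) (upTo (suc n)))

infixl 7 _⊛_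
infixl 6 _⊕_ _⊝_
infixr 8 _^ˢ_

_^ˢ_ : PS → ℕ → PS
f ^ˢ zero  = const (+ 1)
f ^ˢ suc n = f ⊛ (f ^ˢ n)

sumPS : List PS → PS
sumPS = foldr _⊕_ (const (+ 0))

ogf : (ℕ → ℕ) → PS
ogf a n = + a n

prodSX : ℕ → ℕ → PS
prodSX a zero      = const (+ 1)
prodSX a (suc len) = (const (+ a) ⊛ X ⊝ const (+ 1)) ⊛ prodSX (suc a) len

β : ℕ → ℕ → PS
β i j with i ℕ.<ᵇ j
... | true  = const (+ j) ⊛ X ⊛ prodSX (suc i) (j ∸ suc i)
... | false = const (+ 1)

sign : ℕ → ℤ
sign n with n ℕ.% 2
... | zero = + 1
... | suc _ = - (+ 1)

T₁ : ℕ → PS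
T₁ k = sumPS (map (λ j → sumPS (map (λ i → const (sign (i ℕ.+ j)) ⊛ (X ^ˢ i) ⊛ β i j)
                                     (upTo (suc j))))
                  (upTo (k ∸ 1)))

T₂ : ℕ → PS
T₂ k = sumPS (map (λ j → sumPS (map (λ i → const (sign (i ℕ.+ j)) ⊛ const (+ i) ⊛ X ⊛ β i j)
                                     (upTo (suc j))))
                  (upTo (k ∸ 1)))

{-# OPTIONS --safe #-}
module Submission where

-- In a canonical word, a letter b completes a copy of 1 2 ⋯ k 1 2 exactly when some a < b occurs
-- before it but after a letter ≥ b + k − 2.  So, with c = k − 2, a word can be read by an automaton
-- that remembers its maximum m and which of the "critical" letters b ≤ m − c are still allowed:
-- appending a critical a forbids all larger critical letters, and a new maximum adds one allowed
-- critical letter.  Only the number u of allowed critical letters matters, and the series F_u of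
-- continuations satisfy F_u = 1 + x (c F_u + F_1 + ⋯ + F_u + F_{u+1}), whose solution is
-- F_u = y ((1 − c x) y)^u because (1 − c x) y = 1 + (1 − c x) x y².  While m ≤ c nothing is critical,
-- and the series H_m satisfy H_m = 1 + x (m H_m + H_{m+1}) with H_c = F_0 = y.  Solving for H_0
-- produces ∏_{s<m} (1 − s x) and ∑_i x^i ∏_{i<s<m} (1 − s x), to which the β-sums telescope.

open import Defs
open import Algebra.Bundles using (CommutativeRing)
import Algebra.Solver.Ring
open import Algebra.Solver.Ring.AlmostCommutativeRing
  using (AlmostCommutativeRing; fromCommutativeRing; _-Raw-AlmostCommutative⟶_)
open import Data.Bool using (Bool; true; false; T; _∧_; not; if_then_else_)
import Data.Bool.Properties as Boolₚ
open import Data.Integer as ℤ using (ℤ; +_)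
import Data.Integer.Properties as ℤₚ
open import Data.Integer.Tactic.RingSolver using (solve-∀)
open import Data.List
  using (List; []; _∷_; [_]; _++_; map; upTo; applyUpTo; filterᵇ; concatMap; foldl; foldr; length; deduplicate)
open import Data.List.Membership.Propositional using (_∈_)
open import Data.List.Membership.Propositional.Properties
  using (∈-∃++; ∈-++⁺ˡ; ∈-++⁺ʳ; ∈-++⁻; ∈-map⁺; ∈-map⁻; ∈-filter⁺; ∈-filter⁻; ∈-deduplicate⁺; ∈-deduplicate⁻)
open import Data.List.Properties
open import Data.List.Relation.Binary.Sublist.Propositional
  using (_⊆_; []; _∷_; _∷ʳ_; ⊆-refl; ⊆-trans; to∈; minimum)
open import Data.List.Relation.Binary.Sublist.Propositional.Properties using (++⁺; ++⁺ʳ)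
open import Data.List.Relation.Unary.All as All using (_∷_)
open import Data.List.Relation.Unary.Any using (here; there)
open import Data.List.Relation.Unary.Unique.Propositional using (Unique; []; _∷_)
open import Data.List.Relation.Unary.Unique.Propositional.Properties using () renaming (map⁺ to Unique-map⁺)
open import Data.Maybe using (Maybe; just; nothing)
open import Data.Nat as ℕ using (ℕ; zero; suc; _+_; _*_; _∸_; _⊔_; _≤_; _<_; z≤n; s≤s; _≤ᵇ_; _<ᵇ_)
import Data.Nat.Properties as ℕₚ
open import Data.List.Relation.Unary.Unique.DecPropositional.Properties ℕ._≟_ using (deduplicate-!)
open import Data.Product using (∃; ∃₂; _×_; _,_; proj₂)
open import Data.Sum using (inj₁; inj₂)
open import Data.Unit using (tt)
open import Function using (_∘_; id; Equivalence)
open import Level using (0ℓ)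
open import Relation.Binary.Definitions using (tri<; tri≈; tri>)
open import Relation.Binary.PropositionalEquality hiding ([_])
import Relation.Binary.Reasoning.Setoid as SetoidReasoning
open import Relation.Nullary using (¬_; yes; no; contradiction)
open import Relation.Nullary.Decidable using (T?)

-- The ring of power series

tail : PS → PS
tail f n = f (suc n)

⊛-zero : ∀ f g → (f ⊛ g) 0 ≡ f 0 ℤ.* g 0
⊛-zero f g = ℤₚ.+-identityʳ _

-- Splitting off the first summand turns the convolution into a recursion through `tail f`; the ring
-- laws then follow by induction on the coefficient index with the series left general.
⊛-suc : ∀ f g n → (f ⊛ g) (suc n) ≡ f 0 ℤ.* g (suc n) ℤ.+ (tail f ⊛ g) n
⊛-suc f g n = cong (λ l → f 0 ℤ.* g (suc n) ℤ.+ sumℤ l)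
  (trans (map-applyUpTo suc (λ i → f i ℤ.* g (suc n ∸ i)) (suc n))
         (sym (map-applyUpTo id (λ i → f (suc i) ℤ.* g (n ∸ i)) (suc n))))

⊛-cong : ∀ {f f′ g g′} → f ≈ f′ → g ≈ g′ → f ⊛ g ≈ f′ ⊛ g′
⊛-cong {f} {f′} {g} {g′} p q zero = begin
  (f ⊛ g) 0       ≡⟨ ⊛-zero f g ⟩
  f 0 ℤ.* g 0     ≡⟨ cong₂ ℤ._*_ (p 0) (q 0) ⟩
  f′ 0 ℤ.* g′ 0   ≡⟨ ⊛-zero f′ g′ ⟨
  (f′ ⊛ g′) 0     ∎
  where open ≡-Reasoning
⊛-cong {f} {f′} {g} {g′} p q (suc n) = begin
  (f ⊛ g) (suc n)                              ≡⟨ ⊛-suc f g n ⟩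
  f 0 ℤ.* g (suc n) ℤ.+ (tail f ⊛ g) n         ≡⟨ cong₂ ℤ._+_ (cong₂ ℤ._*_ (p 0) (q (suc n)))
                                                    (⊛-cong {tail f} {tail f′} (p ∘ suc) q n) ⟩
  f′ 0 ℤ.* g′ (suc n) ℤ.+ (tail f′ ⊛ g′) n     ≡⟨ ⊛-suc f′ g′ n ⟨
  (f′ ⊛ g′) (suc n)                            ∎
  where open ≡-Reasoning

⊛-distribʳ : ∀ h f g → (f ⊕ g) ⊛ h ≈ f ⊛ h ⊕ g ⊛ h
⊛-distribʳ h f g zero = begin
  ((f ⊕ g) ⊛ h) 0                       ≡⟨ ⊛-zero (f ⊕ g) h ⟩
  (f 0 ℤ.+ g 0) ℤ.* h 0                 ≡⟨ ℤₚ.*-distribʳ-+ (h 0) (f 0) (g 0) ⟩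
  f 0 ℤ.* h 0 ℤ.+ g 0 ℤ.* h 0           ≡⟨ cong₂ ℤ._+_ (⊛-zero f h) (⊛-zero g h) ⟨
  (f ⊛ h) 0 ℤ.+ (g ⊛ h) 0               ∎
  where open ≡-Reasoning
⊛-distribʳ h f g (suc n) = begin
  ((f ⊕ g) ⊛ h) (suc n)                                      ≡⟨ ⊛-suc (f ⊕ g) h n ⟩
  (f 0 ℤ.+ g 0) ℤ.* h (suc n) ℤ.+ ((tail f ⊕ tail g) ⊛ h) n  ≡⟨ cong (ℤ._+_ (((f ⊕ g) 0 ℤ.* h (suc n))))
                                                                  (⊛-distribʳ h (tail f) (tail g) n) ⟩
  (f 0 ℤ.+ g 0) ℤ.* h (suc n) ℤ.+ ((tail f ⊛ h) n ℤ.+ (tail g ⊛ h) n)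
                                                             ≡⟨ rearrange (f 0) (g 0) (h (suc n)) _ _ ⟩
  (f 0 ℤ.* h (suc n) ℤ.+ (tail f ⊛ h) n) ℤ.+ (g 0 ℤ.* h (suc n) ℤ.+ (tail g ⊛ h) n)
                                                             ≡⟨ cong₂ ℤ._+_ (⊛-suc f h n) (⊛-suc g h n) ⟨
  (f ⊛ h) (suc n) ℤ.+ (g ⊛ h) (suc n)                        ∎
  where
  open ≡-Reasoning
  rearrange : ∀ a b c d e → (a ℤ.+ b) ℤ.* c ℤ.+ (d ℤ.+ e) ≡ (a ℤ.* c ℤ.+ d) ℤ.+ (b ℤ.* c ℤ.+ e)
  rearrange = solve-∀

-- The mirror image of `⊛-suc`, splitting off the last summand; the two together give commutativity
-- by induction.
⊛-sucʳ : ∀ f g n → (f ⊛ g) (suc n) ≡ f (suc n) ℤ.* g 0 ℤ.+ (f ⊛ tail g) n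
⊛-sucʳ f g zero = begin
  (f ⊛ g) 1                               ≡⟨ ⊛-suc f g 0 ⟩
  f 0 ℤ.* g 1 ℤ.+ (tail f ⊛ g) 0          ≡⟨ cong (ℤ._+_ (f 0 ℤ.* g 1)) (⊛-zero (tail f) g) ⟩
  f 0 ℤ.* g 1 ℤ.+ f 1 ℤ.* g 0             ≡⟨ ℤₚ.+-comm (f 0 ℤ.* g 1) (f 1 ℤ.* g 0) ⟩
  f 1 ℤ.* g 0 ℤ.+ f 0 ℤ.* g 1             ≡⟨ cong (ℤ._+_ (f 1 ℤ.* g 0)) (⊛-zero f (tail g)) ⟨
  f 1 ℤ.* g 0 ℤ.+ (f ⊛ tail g) 0          ∎
  where open ≡-Reasoning
⊛-sucʳ f g (suc n) = begin
  (f ⊛ g) (suc (suc n))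
    ≡⟨ ⊛-suc f g (suc n) ⟩
  f 0 ℤ.* g (suc (suc n)) ℤ.+ (tail f ⊛ g) (suc n)
    ≡⟨ cong (ℤ._+_ (f 0 ℤ.* g (suc (suc n)))) (⊛-sucʳ (tail f) g n) ⟩
  f 0 ℤ.* g (suc (suc n)) ℤ.+ (f (suc (suc n)) ℤ.* g 0 ℤ.+ (tail f ⊛ tail g) n)
    ≡⟨ rearrange (f 0 ℤ.* g (suc (suc n))) (f (suc (suc n)) ℤ.* g 0) _ ⟩
  f (suc (suc n)) ℤ.* g 0 ℤ.+ (f 0 ℤ.* g (suc (suc n)) ℤ.+ (tail f ⊛ tail g) n)
    ≡⟨ cong (ℤ._+_ (f (suc (suc n)) ℤ.* g 0)) (⊛-suc f (tail g) n) ⟨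
  f (suc (suc n)) ℤ.* g 0 ℤ.+ (f ⊛ tail g) (suc n)
    ∎
  where
  open ≡-Reasoning
  rearrange : ∀ a b c → a ℤ.+ (b ℤ.+ c) ≡ b ℤ.+ (a ℤ.+ c)
  rearrange = solve-∀

⊛-comm : ∀ f g → f ⊛ g ≈ g ⊛ f
⊛-comm f g zero = trans (⊛-zero f g) (trans (ℤₚ.*-comm (f 0) (g 0)) (sym (⊛-zero g f)))
⊛-comm f g (suc n) = begin
  (f ⊛ g) (suc n)                        ≡⟨ ⊛-suc f g n ⟩
  f 0 ℤ.* g (suc n) ℤ.+ (tail f ⊛ g) n   ≡⟨ cong₂ ℤ._+_ (ℤₚ.*-comm (f 0) (g (suc n))) (⊛-comm (tail f) g n) ⟩
  g (suc n) ℤ.* f 0 ℤ.+ (g ⊛ tail f) n   ≡⟨ ⊛-sucʳ g f n ⟨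
  (g ⊛ f) (suc n)                        ∎
  where open ≡-Reasoning

-- Serves associativity: by `⊛-suc`, `tail (f ⊛ g)` is `scale (f 0) (tail g) ⊕ tail f ⊛ g`.
scale : ℤ → PS → PS
scale a f n = a ℤ.* f n

⊛-scale : ∀ a f g n → (scale a f ⊛ g) n ≡ a ℤ.* (f ⊛ g) n
⊛-scale a f g zero = begin
  (scale a f ⊛ g) 0      ≡⟨ ⊛-zero (scale a f) g ⟩
  a ℤ.* f 0 ℤ.* g 0      ≡⟨ ℤₚ.*-assoc a (f 0) (g 0) ⟩
  a ℤ.* (f 0 ℤ.* g 0)    ≡⟨ cong (a ℤ.*_) (⊛-zero f g) ⟨
  a ℤ.* (f ⊛ g) 0        ∎
  where open ≡-Reasoning
⊛-scale a f g (suc n) = begin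
  (scale a f ⊛ g) (suc n)                                   ≡⟨ ⊛-suc (scale a f) g n ⟩
  a ℤ.* f 0 ℤ.* g (suc n) ℤ.+ (scale a (tail f) ⊛ g) n      ≡⟨ cong₂ ℤ._+_ (ℤₚ.*-assoc a (f 0) (g (suc n)))
                                                                 (⊛-scale a (tail f) g n) ⟩
  a ℤ.* (f 0 ℤ.* g (suc n)) ℤ.+ a ℤ.* (tail f ⊛ g) n        ≡⟨ ℤₚ.*-distribˡ-+ a _ _ ⟨
  a ℤ.* (f 0 ℤ.* g (suc n) ℤ.+ (tail f ⊛ g) n)              ≡⟨ cong (a ℤ.*_) (⊛-suc f g n) ⟨
  a ℤ.* (f ⊛ g) (suc n)                                     ∎
  where open ≡-Reasoning

⊛-assoc : ∀ f g h → (f ⊛ g) ⊛ h ≈ f ⊛ (g ⊛ h)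
⊛-assoc f g h zero = begin
  ((f ⊛ g) ⊛ h) 0              ≡⟨ ⊛-zero (f ⊛ g) h ⟩
  (f ⊛ g) 0 ℤ.* h 0            ≡⟨ cong (ℤ._* h 0) (⊛-zero f g) ⟩
  f 0 ℤ.* g 0 ℤ.* h 0          ≡⟨ ℤₚ.*-assoc (f 0) (g 0) (h 0) ⟩
  f 0 ℤ.* (g 0 ℤ.* h 0)        ≡⟨ cong (f 0 ℤ.*_) (⊛-zero g h) ⟨
  f 0 ℤ.* (g ⊛ h) 0            ≡⟨ ⊛-zero f (g ⊛ h) ⟨
  (f ⊛ (g ⊛ h)) 0              ∎
  where open ≡-Reasoning
⊛-assoc f g h (suc n) = begin
  ((f ⊛ g) ⊛ h) (suc n)
    ≡⟨ ⊛-suc (f ⊛ g) h n ⟩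
  (f ⊛ g) 0 ℤ.* h (suc n) ℤ.+ (tail (f ⊛ g) ⊛ h) n
    ≡⟨ cong₂ ℤ._+_ (cong (ℤ._* h (suc n)) (⊛-zero f g))
         (⊛-cong {tail (f ⊛ g)} {scale (f 0) (tail g) ⊕ tail f ⊛ g} {h} {h} (⊛-suc f g) (λ _ → refl) n) ⟩
  f 0 ℤ.* g 0 ℤ.* h (suc n) ℤ.+ ((scale (f 0) (tail g) ⊕ tail f ⊛ g) ⊛ h) n
    ≡⟨ cong (ℤ._+_ (f 0 ℤ.* g 0 ℤ.* h (suc n))) (trans
         (⊛-distribʳ h (scale (f 0) (tail g)) (tail f ⊛ g) n)
         (cong₂ ℤ._+_ (⊛-scale (f 0) (tail g) h n) (⊛-assoc (tail f) g h n))) ⟩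
  f 0 ℤ.* g 0 ℤ.* h (suc n) ℤ.+ (f 0 ℤ.* (tail g ⊛ h) n ℤ.+ (tail f ⊛ (g ⊛ h)) n)
    ≡⟨ rearrange (f 0) (g 0) (h (suc n)) _ _ ⟩
  f 0 ℤ.* (g 0 ℤ.* h (suc n) ℤ.+ (tail g ⊛ h) n) ℤ.+ (tail f ⊛ (g ⊛ h)) n
    ≡⟨ cong (λ e → f 0 ℤ.* e ℤ.+ (tail f ⊛ (g ⊛ h)) n) (⊛-suc g h n) ⟨
  f 0 ℤ.* (g ⊛ h) (suc n) ℤ.+ (tail f ⊛ (g ⊛ h)) n
    ≡⟨ ⊛-suc f (g ⊛ h) n ⟨
  (f ⊛ (g ⊛ h)) (suc n)
    ∎
  where
  open ≡-Reasoning
  rearrange : ∀ a b c d e → a ℤ.* b ℤ.* c ℤ.+ (a ℤ.* d ℤ.+ e) ≡ a ℤ.* (b ℤ.* c ℤ.+ d) ℤ.+ e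
  rearrange = solve-∀

⊛-zeroˡ : ∀ f g → (∀ n → f n ≡ + 0) → ∀ n → (f ⊛ g) n ≡ + 0
⊛-zeroˡ f g f≈0 zero = trans (⊛-zero f g) (cong (ℤ._* g 0) (f≈0 0))
⊛-zeroˡ f g f≈0 (suc n) = trans (⊛-suc f g n)
  (cong₂ ℤ._+_ (cong (ℤ._* g (suc n)) (f≈0 0)) (⊛-zeroˡ (tail f) g (f≈0 ∘ suc) n))

const-⊛ : ∀ a f n → (const a ⊛ f) n ≡ a ℤ.* f n
const-⊛ a f zero    = ⊛-zero (const a) f
const-⊛ a f (suc n) = trans (⊛-suc (const a) f n)
  (trans (cong (ℤ._+_ (a ℤ.* f (suc n))) (⊛-zeroˡ (tail (const a)) f (λ _ → refl) n)) (ℤₚ.+-identityʳ _))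

X-⊛-zero : ∀ f → (X ⊛ f) 0 ≡ + 0
X-⊛-zero f = ⊛-zero X f

X-⊛-suc : ∀ f n → (X ⊛ f) (suc n) ≡ f n
X-⊛-suc f n = begin
  (X ⊛ f) (suc n)                    ≡⟨ ⊛-suc X f n ⟩
  + 0 ℤ.+ (tail X ⊛ f) n             ≡⟨ ℤₚ.+-identityˡ _ ⟩
  (tail X ⊛ f) n                     ≡⟨ ⊛-cong {tail X} {const (+ 1)} {f} {f} tailX (λ _ → refl) n ⟩
  (const (+ 1) ⊛ f) n                ≡⟨ const-⊛ (+ 1) f n ⟩
  + 1 ℤ.* f n                        ≡⟨ ℤₚ.*-identityˡ (f n) ⟩
  f n                                ∎
  where
  open ≡-Reasoning
  tailX : tail X ≈ const (+ 1)
  tailX zero    = refl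
  tailX (suc _) = refl

const-+ : ∀ a b → const (a ℤ.+ b) ≈ const a ⊕ const b
const-+ a b zero    = refl
const-+ a b (suc n) = refl

const-* : ∀ a b → const (a ℤ.* b) ≈ const a ⊛ const b
const-* a b zero    = sym (const-⊛ a (const b) 0)
const-* a b (suc n) = sym (trans (const-⊛ a (const b) (suc n)) (ℤₚ.*-zeroʳ a))

const-neg : ∀ a → const (ℤ.- a) ≈ ⊖ const a
const-neg a zero    = refl
const-neg a (suc n) = refl

const-0 : ∀ n → const (+ 0) n ≡ + 0
const-0 zero    = refl
const-0 (suc n) = refl

-- _≈_ unfolds to a function type, from which the two series cannot be inferred; the record can be.
infix 4 _≋_
record _≋_ (f g : PS) : Set where
  constructor pointwise
  field at : f ≈ g
open _≋_

PS-commutativeRing : CommutativeRing 0ℓ 0ℓ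
PS-commutativeRing = record
  { Carrier = PS
  ; _≈_ = _≋_
  ; _+_ = _⊕_
  ; _*_ = _⊛_
  ; -_ = ⊖_
  ; 0# = const (+ 0)
  ; 1# = const (+ 1)
  ; isCommutativeRing = record
    { isRing = record
      { +-isAbelianGroup = record
        { isGroup = record
          { isMonoid = record
            { isSemigroup = record
              { isMagma = record
                { isEquivalence = record
                  { refl = pointwise λ _ → refl
                  ; sym = λ p → pointwise λ n → sym (at p n)
                  ; trans = λ p q → pointwise λ n → trans (at p n) (at q n)
                  }
                ; ∙-cong = λ p q → pointwise λ n → cong₂ ℤ._+_ (at p n) (at q n)
                }
              ; assoc = λ f g h → pointwise λ n → ℤₚ.+-assoc (f n) (g n) (h n)
              }
            ; identity =
                (λ f → pointwise λ n → trans (cong (ℤ._+ f n) (const-0 n)) (ℤₚ.+-identityˡ (f n)))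
              , (λ f → pointwise λ n → trans (cong (ℤ._+_ (f n)) (const-0 n)) (ℤₚ.+-identityʳ (f n)))
            }
          ; inverse = (λ f → pointwise λ n → trans (ℤₚ.+-inverseˡ (f n)) (sym (const-0 n)))
                    , (λ f → pointwise λ n → trans (ℤₚ.+-inverseʳ (f n)) (sym (const-0 n)))
          ; ⁻¹-cong = λ p → pointwise λ n → cong ℤ.-_ (at p n)
          }
        ; comm = λ f g → pointwise λ n → ℤₚ.+-comm (f n) (g n)
        }
      ; *-cong = λ p q → pointwise (⊛-cong (at p) (at q))
      ; *-assoc = λ f g h → pointwise (⊛-assoc f g h)
      ; *-identity =
          (λ f → pointwise (⊛-identityˡ f))
        , (λ f → pointwise λ n → trans (⊛-comm f (const (+ 1)) n) (⊛-identityˡ f n))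
      ; distrib =
          (λ f g h → pointwise λ n → trans (⊛-comm f (g ⊕ h) n) (trans (⊛-distribʳ f g h n)
                                       (cong₂ ℤ._+_ (⊛-comm g f n) (⊛-comm h f n))))
        , (λ h f g → pointwise (⊛-distribʳ h f g))
      }
    ; *-comm = λ f g → pointwise (⊛-comm f g)
    }
  }
  where
  ⊛-identityˡ : ∀ f → const (+ 1) ⊛ f ≈ f
  ⊛-identityˡ f n = trans (const-⊛ (+ 1) f n) (ℤₚ.*-identityˡ (f n))

PS-almostCommutativeRing : AlmostCommutativeRing 0ℓ 0ℓ
PS-almostCommutativeRing = fromCommutativeRing PS-commutativeRing

const-morphism : CommutativeRing.rawRing ℤₚ.+-*-commutativeRing -Raw-AlmostCommutative⟶ PS-almostCommutativeRing
const-morphism = record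
  { ⟦_⟧    = const
  ; +-homo = λ a b → pointwise (const-+ a b)
  ; *-homo = λ a b → pointwise (const-* a b)
  ; -‿homo = λ a → pointwise (const-neg a)
  ; 0-homo = pointwise λ _ → refl
  ; 1-homo = pointwise λ _ → refl
  }

const-≟ : ∀ a b → Maybe (const a ≋ const b)
const-≟ a b with a ℤ.≟ b
... | yes a≡b = just (pointwise λ n → cong (λ c → const c n) a≡b)
... | no _    = nothing

module PS-Solver = Algebra.Solver.Ring
  (CommutativeRing.rawRing ℤₚ.+-*-commutativeRing) PS-almostCommutativeRing const-morphism const-≟

-- Identities between power series

module R = CommutativeRing PS-commutativeRing
module ≋-Reasoning = SetoidReasoning R.setoid

1ₛ 0ₛ : PS
1ₛ = const (+ 1)
0ₛ = const (+ 0)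

linear : ℕ → PS
linear a = 1ₛ ⊝ const (+ a) ⊛ X

-- The first of three cancellation laws, for the factors x, 4 and 1 - c x that separate
-- `y-quadratic` from the given formula for y.
X-cancel : ∀ f → X ⊛ f ≋ 0ₛ → f ≋ 0ₛ
X-cancel f p = pointwise λ n → trans (sym (X-⊛-suc f n)) (trans (at p (suc n)) (sym (const-0 n)))

const-cancel : ∀ a f → const (+ suc a) ⊛ f ≋ 0ₛ → f ≋ 0ₛ
const-cancel a f p = pointwise λ n → trans
  (ℤₚ.*-cancelˡ-≡ (+ suc a) (f n) (+ 0)
    (trans (sym (const-⊛ (+ suc a) f n)) (trans (at p n) (trans (const-0 n) (sym (ℤₚ.*-zeroʳ (+ suc a)))))))
  (sym (const-0 n))

-- From f = a x f each coefficient is a times the previous one, and the constant coefficient is 0.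
linear-cancel : ∀ a f → linear a ⊛ f ≋ 0ₛ → f ≋ 0ₛ
linear-cancel a f p = pointwise λ n → trans (vanishes n) (sym (const-0 n))
  where
  open PS-Solver
  fixed : f ≋ const (+ a) ⊛ (X ⊛ f)
  fixed = begin
    f                                            ≈⟨ solve 3 (λ c x f → f := (con (+ 1) :- c :* x) :* f :+ c :* (x :* f))
                                                      R.refl (const (+ a)) X f ⟩
    linear a ⊛ f ⊕ const (+ a) ⊛ (X ⊛ f)         ≈⟨ R.+-congʳ p ⟩
    0ₛ ⊕ const (+ a) ⊛ (X ⊛ f)                   ≈⟨ R.+-identityˡ _ ⟩
    const (+ a) ⊛ (X ⊛ f)                        ∎
    where open ≋-Reasoning
  times-zero : ∀ {e} → e ≡ + 0 → + a ℤ.* e ≡ + 0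
  times-zero refl = ℤₚ.*-zeroʳ (+ a)
  vanishes : ∀ n → f n ≡ + 0
  vanishes zero    = trans (at fixed 0) (trans (const-⊛ (+ a) (X ⊛ f) 0) (times-zero (X-⊛-zero f)))
  vanishes (suc n) = trans (at fixed (suc n)) (trans (const-⊛ (+ a) (X ⊛ f) (suc n))
    (times-zero (trans (X-⊛-suc f n) (vanishes n))))

-- The quadratic equation of y

module _ (c : ℕ) (S y : PS)
  (S²    : S ⊛ S ≋ linear (suc (suc c)) ^ˢ 2 ⊝ const (+ 4) ⊛ X ^ˢ 2)
  (S-via-y : const (+ 2) ⊛ X ⊛ linear c ⊛ y ≋ linear c ⊝ S)
  where

  private
    p = linear c
  open PS-Solver

  -- As an equation in y, p x y² - p y + 1 = 0 has discriminant p² - 4 p x, which equals (1 - k x)²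
  -- - 4 x² because 1 - k x = p - 2 x for k = c + 2. The given formula for y is therefore its
  -- quadratic formula.
  y-quadratic : p ⊛ y ≋ 1ₛ ⊕ p ⊛ X ⊛ y ⊛ y
  y-quadratic = begin
    p ⊛ y                                ≈⟨ R.+-identityˡ _ ⟨
    0ₛ ⊕ p ⊛ y                           ≈⟨ R.+-congʳ E≋0 ⟨
    E ⊕ p ⊛ y                            ≈⟨ solve 3 (λ p x y → (con (+ 1) :+ p :* x :* y :* y :- p :* y) :+ p :* y
                                                := con (+ 1) :+ p :* x :* y :* y) R.refl p X y ⟩
    1ₛ ⊕ p ⊛ X ⊛ y ⊛ y                   ∎
    where
    open ≋-Reasoning
    -- 4 x p E is the difference of the two expressions for S² given by S-via-y and S².
    E : PS
    E = 1ₛ ⊕ p ⊛ X ⊛ y ⊛ y ⊝ p ⊛ y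
    S-solved : p ⊝ const (+ 2) ⊛ X ⊛ p ⊛ y ≋ S
    S-solved = R.trans (R.+-congˡ {p} (R.-‿cong S-via-y))
      (solve 2 (λ p s → p :- (p :- s) := s) R.refl p S)
    discriminant : linear (suc (suc c)) ^ˢ 2 ⊝ const (+ 4) ⊛ X ^ˢ 2 ≋ p ⊛ p ⊝ const (+ 4) ⊛ X ⊛ p
    discriminant = begin
      linear (suc (suc c)) ^ˢ 2 ⊝ const (+ 4) ⊛ X ^ˢ 2
        ≈⟨ R.+-congʳ (R.*-cong split (R.*-congʳ split)) ⟩
      (1ₛ ⊝ (const (+ 2) ⊕ const (+ c)) ⊛ X) ^ˢ 2 ⊝ const (+ 4) ⊛ X ^ˢ 2
        ≈⟨ solve 2 (λ c x → (con (+ 1) :- (con (+ 2) :+ c) :* x) :* ((con (+ 1) :- (con (+ 2) :+ c) :* x) :* con (+ 1))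
                              :- con (+ 4) :* (x :* (x :* con (+ 1)))
                            := (con (+ 1) :- c :* x) :* (con (+ 1) :- c :* x) :- con (+ 4) :* x :* (con (+ 1) :- c :* x))
             R.refl (const (+ c)) X ⟩
      p ⊛ p ⊝ const (+ 4) ⊛ X ⊛ p ∎
      where
      split : linear (suc (suc c)) ≋ 1ₛ ⊝ (const (+ 2) ⊕ const (+ c)) ⊛ X
      split = R.+-congˡ {1ₛ} (R.-‿cong (R.*-congʳ {X} (pointwise (const-+ (+ 2) (+ c)))))
    E≋0 : E ≋ 0ₛ
    -- The argument 3 of `const-cancel` stands for the factor `suc 3`, that is 4.
    E≋0 = linear-cancel c E (X-cancel (p ⊛ E) (const-cancel 3 (X ⊛ (p ⊛ E)) (begin
      const (+ 4) ⊛ (X ⊛ (p ⊛ E))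
        ≈⟨ solve 3 (λ p x y → con (+ 4) :* (x :* (p :* (con (+ 1) :+ p :* x :* y :* y :- p :* y)))
             := (p :- con (+ 2) :* x :* p :* y) :* (p :- con (+ 2) :* x :* p :* y)
                :- (p :* p :- con (+ 4) :* x :* p)) R.refl p X y ⟩
      (p ⊝ const (+ 2) ⊛ X ⊛ p ⊛ y) ⊛ (p ⊝ const (+ 2) ⊛ X ⊛ p ⊛ y) ⊝ (p ⊛ p ⊝ const (+ 4) ⊛ X ⊛ p)
        ≈⟨ R.+-cong (R.*-cong S-solved S-solved) (R.-‿cong (R.sym (R.trans S² discriminant))) ⟩
      S ⊛ S ⊝ S ⊛ S
        ≈⟨ R.-‿inverseʳ (S ⊛ S) ⟩
      0ₛ ∎)))

-- Solving the recurrence of the series F_u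

module _ (c : ℕ) (y : PS) where

  G : ℕ → PS
  G u = y ⊛ (linear c ⊛ y) ^ˢ u

  -- Starts at index 1 because appending the r-th allowed critical letter leaves r of them allowed,
  -- the letter itself included.
  ΣG : ℕ → PS
  ΣG zero    = 0ₛ
  ΣG (suc u) = ΣG u ⊕ G (suc u)

module _ (c : ℕ) (y : PS) (y-quadratic : linear c ⊛ y ≋ 1ₛ ⊕ linear c ⊛ X ⊛ y ⊛ y) where

  private
    p = linear c
  open PS-Solver
  open ≋-Reasoning

  -- The quadratic equation reads p y (1 - x y) = 1, and inverses are unique.
  inverse-1⊝Xy : ∀ w → w ⊛ (1ₛ ⊝ X ⊛ y) ≋ 1ₛ → w ≋ p ⊛ y
  inverse-1⊝Xy w w-inverse = begin
    w
      ≈⟨ solve 4 (λ w p x y → w := w :* (con (+ 1) :+ p :* x :* y :* y) :- w :* (p :* x :* y :* y)) R.refl w p X y ⟩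
    w ⊛ (1ₛ ⊕ p ⊛ X ⊛ y ⊛ y) ⊝ w ⊛ (p ⊛ X ⊛ y ⊛ y)
      ≈⟨ R.+-congʳ (R.*-congˡ {w} y-quadratic) ⟨
    w ⊛ (p ⊛ y) ⊝ w ⊛ (p ⊛ X ⊛ y ⊛ y)
      ≈⟨ solve 4 (λ w p x y → w :* (p :* y) :- w :* (p :* x :* y :* y) := w :* (con (+ 1) :- x :* y) :* (p :* y))
           R.refl w p X y ⟩
    w ⊛ (1ₛ ⊝ X ⊛ y) ⊛ (p ⊛ y)
      ≈⟨ R.*-congʳ w-inverse ⟩
    1ₛ ⊛ (p ⊛ y)
      ≈⟨ R.*-identityˡ _ ⟩
    p ⊛ y ∎

  -- Subtracting the equations for u and u + 1 leaves p (F_{u+1} - F_u) = x F_{u+2}. For F_u = y r^u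
  -- with r = p y this amounts to r - 1 = p x y², the quadratic equation again, which also settles u
  -- = 0.
  G-equation : ∀ u → G c y u ≋ 1ₛ ⊕ X ⊛ (const (+ c) ⊛ G c y u ⊕ ΣG c y u ⊕ G c y (suc u))
  G-equation zero = begin
    y ⊛ 1ₛ
      ≈⟨ solve 3 (λ c x y → y :* con (+ 1) := (con (+ 1) :- c :* x) :* y :+ c :* x :* y) R.refl (const (+ c)) X y ⟩
    p ⊛ y ⊕ const (+ c) ⊛ X ⊛ y
      ≈⟨ R.+-congʳ y-quadratic ⟩
    1ₛ ⊕ p ⊛ X ⊛ y ⊛ y ⊕ const (+ c) ⊛ X ⊛ y
      ≈⟨ solve 4 (λ p c x y → con (+ 1) :+ p :* x :* y :* y :+ c :* x :* y
                 := con (+ 1) :+ x :* (c :* (y :* con (+ 1)) :+ con (+ 0) :+ y :* (p :* y :* con (+ 1))))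
           R.refl p (const (+ c)) X y ⟩
    1ₛ ⊕ X ⊛ (const (+ c) ⊛ G c y 0 ⊕ ΣG c y 0 ⊕ G c y 1) ∎
  G-equation (suc u) = begin
    y ⊛ (p ⊛ y ⊛ q)
      ≈⟨ solve 4 (λ c x y q → y :* ((con (+ 1) :- c :* x) :* y :* q)
                   := y :* q :+ c :* x :* (y :* ((con (+ 1) :- c :* x) :* y :* q) :- y :* q)
                      :+ y :* q :* (con (+ 1) :- c :* x) :* ((con (+ 1) :- c :* x) :* y :- con (+ 1)))
           R.refl (const (+ c)) X y q ⟩
    G c y u ⊕ const (+ c) ⊛ X ⊛ (G c y (suc u) ⊝ G c y u) ⊕ y ⊛ q ⊛ p ⊛ (p ⊛ y ⊝ 1ₛ)
      ≈⟨ R.+-cong (R.+-congʳ (G-equation u)) (R.*-congˡ {y ⊛ q ⊛ p} (R.+-congʳ y-quadratic)) ⟩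
    1ₛ ⊕ X ⊛ (const (+ c) ⊛ G c y u ⊕ ΣG c y u ⊕ G c y (suc u)) ⊕ const (+ c) ⊛ X ⊛ (G c y (suc u) ⊝ G c y u)
      ⊕ y ⊛ q ⊛ p ⊛ (1ₛ ⊕ p ⊛ X ⊛ y ⊛ y ⊝ 1ₛ)
      ≈⟨ solve 6 (λ p c x y q s → con (+ 1) :+ x :* (c :* (y :* q) :+ s :+ y :* (p :* y :* q))
                    :+ c :* x :* (y :* (p :* y :* q) :- y :* q)
                    :+ y :* q :* p :* (con (+ 1) :+ p :* x :* y :* y :- con (+ 1))
                  := con (+ 1) :+ x :* (c :* (y :* (p :* y :* q)) :+ (s :+ y :* (p :* y :* q)) :+ y :* (p :* y :* (p :* y :* q))))
           R.refl p (const (+ c)) X y q (ΣG c y u) ⟩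
    1ₛ ⊕ X ⊛ (const (+ c) ⊛ G c y (suc u) ⊕ ΣG c y (suc u) ⊕ G c y (suc (suc u))) ∎
    where q = (p ⊛ y) ^ˢ u

-- Finite sums and the sums over β

∑< : (ℕ → PS) → ℕ → PS
∑< f zero    = 0ₛ
∑< f (suc n) = ∑< f n ⊕ f n

∑<-cong : ∀ {f g} n → (∀ i → i < n → f i ≋ g i) → ∑< f n ≋ ∑< g n
∑<-cong zero    p = R.refl
∑<-cong (suc n) p = R.+-cong (∑<-cong n (λ i i<n → p i (ℕₚ.m<n⇒m<1+n i<n))) (p n (ℕₚ.n<1+n n))

∑<-distribˡ : ∀ a f n → ∑< (λ i → a ⊛ f i) n ≋ a ⊛ ∑< f n
∑<-distribˡ a f zero    = R.sym (R.zeroʳ a)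
∑<-distribˡ a f (suc n) = R.trans (R.+-congʳ (∑<-distribˡ a f n)) (R.sym (R.distribˡ a (∑< f n) (f n)))

sumPS-∷ʳ : ∀ fs g → sumPS (fs ++ [ g ]) ≋ sumPS fs ⊕ g
sumPS-∷ʳ []       g = R.+-comm g 0ₛ
sumPS-∷ʳ (f ∷ fs) g = R.trans (R.+-congˡ {f} (sumPS-∷ʳ fs g)) (R.sym (R.+-assoc f (sumPS fs) g))

sumPS-upTo : ∀ f n → sumPS (map f (upTo n)) ≋ ∑< f n
sumPS-upTo f zero    = R.refl
sumPS-upTo f (suc n) = begin
  sumPS (map f (upTo (suc n)))        ≡⟨ cong (sumPS ∘ map f) (upTo-∷ʳ n) ⟨
  sumPS (map f (upTo n ++ [ n ]))     ≡⟨ cong sumPS (map-++ f (upTo n) [ n ]) ⟩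
  sumPS (map f (upTo n) ++ [ f n ])   ≈⟨ sumPS-∷ʳ (map f (upTo n)) (f n) ⟩
  sumPS (map f (upTo n)) ⊕ f n        ≈⟨ R.+-congʳ (sumPS-upTo f n) ⟩
  ∑< f n ⊕ f n                        ∎
  where open ≋-Reasoning

sumPS-map-cong : ∀ {f g} n → (∀ i → f i ≋ g i) → sumPS (map f (upTo n)) ≋ sumPS (map g (upTo n))
sumPS-map-cong {f} {g} n p =
  R.trans (sumPS-upTo f n) (R.trans (∑<-cong n (λ i _ → p i)) (R.sym (sumPS-upTo g n)))

sign-suc : ∀ n → sign (suc n) ≡ ℤ.- sign n
sign-suc zero          = refl
sign-suc (suc zero)    = refl
sign-suc (suc (suc n)) = sign-suc n

sign-double : ∀ n → sign (n ℕ.+ n) ≡ + 1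
sign-double zero    = refl
sign-double (suc n) = trans (cong (sign ∘ suc) (ℕₚ.+-suc n n)) (sign-double n)

-- `prodSX` recurses at its lower end, whereas passing from j to j + 1 in β adds a factor at the
-- upper end.
prodSX-snoc : ∀ a l → prodSX a (suc l) ≋ prodSX a l ⊛ (const (+ (a ℕ.+ l)) ⊛ X ⊝ 1ₛ)
prodSX-snoc a zero rewrite ℕₚ.+-identityʳ a = R.*-comm (const (+ a) ⊛ X ⊝ 1ₛ) 1ₛ
prodSX-snoc a (suc l) rewrite ℕₚ.+-suc a l =
  R.trans (R.*-congˡ {const (+ a) ⊛ X ⊝ 1ₛ} (prodSX-snoc (suc a) l))
          (R.sym (R.*-assoc (const (+ a) ⊛ X ⊝ 1ₛ) (prodSX (suc a) l) _))

β-< : ∀ {i j} → i < j → β i j ≋ const (+ j) ⊛ X ⊛ prodSX (suc i) (j ∸ suc i)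
β-< {i} {j} i<j with i ℕ.<ᵇ j | ℕₚ.<⇒<ᵇ i<j
... | true | _ = R.refl

β-diagonal : ∀ j → β j j ≋ 1ₛ
β-diagonal j with j ℕ.<ᵇ j in eq
... | false = R.refl
... | true  = contradiction (ℕₚ.<ᵇ⇒< j j (subst T (sym eq) _)) (ℕₚ.n≮n j)

-- gapProduct i j = ∏_{i<s<j} (1 − s x), and (−1)^(i+j) β_{i,j} = − j x · gapProduct i j.
gapProduct : ℕ → ℕ → PS
gapProduct i j = const (sign (suc (i ℕ.+ j))) ⊛ prodSX (suc i) (j ∸ suc i)

-- Raising j flips the sign, and this turns the new factor j x - 1 into 1 - j x.
gapProduct-suc : ∀ {i j} → i < j → gapProduct i (suc j) ≋ linear j ⊛ gapProduct i j
gapProduct-suc {i} {j} i<j = begin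
  const (sign (suc (i ℕ.+ suc j))) ⊛ prodSX (suc i) (j ∸ i)
    ≡⟨ cong₂ (λ s l → const s ⊛ prodSX (suc i) l)
         (trans (cong (sign ∘ suc) (ℕₚ.+-suc i j)) (sign-suc (suc (i ℕ.+ j))))
         (ℕₚ.+-∸-assoc 1 i<j) ⟩
  const (ℤ.- s) ⊛ prodSX (suc i) (suc l)
    ≈⟨ R.*-cong (pointwise (const-neg s)) (prodSX-snoc (suc i) l) ⟩
  ⊖ const s ⊛ (prodSX (suc i) l ⊛ (const (+ (suc i ℕ.+ l)) ⊛ X ⊝ 1ₛ))
    ≡⟨ cong (λ e → ⊖ const s ⊛ (prodSX (suc i) l ⊛ (const (+ e) ⊛ X ⊝ 1ₛ))) (ℕₚ.m+[n∸m]≡n i<j) ⟩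
  ⊖ const s ⊛ (prodSX (suc i) l ⊛ (const (+ j) ⊛ X ⊝ 1ₛ))
    ≈⟨ solve 4 (λ s q j x → :- s :* (q :* (j :* x :- con (+ 1))) := (con (+ 1) :- j :* x) :* (s :* q))
         R.refl (const s) (prodSX (suc i) l) (const (+ j)) X ⟩
  linear j ⊛ gapProduct i j ∎
  where
  open ≋-Reasoning
  open PS-Solver
  s = sign (suc (i ℕ.+ j))
  l = j ∸ suc i

gapProduct-adjacent : ∀ j → gapProduct j (suc j) ≋ 1ₛ
gapProduct-adjacent j = begin
  const (sign (suc (j ℕ.+ suc j))) ⊛ prodSX (suc j) (j ∸ j)
    ≡⟨ cong₂ (λ s l → const s ⊛ prodSX (suc j) l)
         (trans (cong (sign ∘ suc) (ℕₚ.+-suc j j)) (sign-double j)) (ℕₚ.n∸n≡0 j) ⟩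
  1ₛ ⊛ 1ₛ ≈⟨ R.*-identityˡ 1ₛ ⟩
  1ₛ ∎
  where open ≋-Reasoning

module _ (a : ℕ → PS) where

  -- The common shape of the two double sums: `T₁` has a_i = x^i and `T₂` has a_i = i x.
  signedSum : ℕ → PS
  signedSum K = sumPS (map (λ j → sumPS (map (λ i → const (sign (i ℕ.+ j)) ⊛ a i ⊛ β i j) (upTo (suc j)))) (upTo K))

  -- The sum over i < m of a_i ∏_{i<s<m} (1 - s x), in Horner form.
  weightedSum : ℕ → PS
  weightedSum zero    = 0ₛ
  weightedSum (suc j) = linear j ⊛ weightedSum j ⊕ a j

  ∑-gapProduct : ∀ j → ∑< (λ i → a i ⊛ gapProduct i j) j ≋ weightedSum j
  ∑-gapProduct zero    = R.refl
  ∑-gapProduct (suc j) = R.+-cong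
    (begin
      ∑< (λ i → a i ⊛ gapProduct i (suc j)) j
        ≈⟨ ∑<-cong j (λ i i<j → R.trans (R.*-congˡ {a i} (gapProduct-suc i<j))
             (solve 3 (λ a p g → a :* (p :* g) := p :* (a :* g)) R.refl (a i) (linear j) (gapProduct i j))) ⟩
      ∑< (λ i → linear j ⊛ (a i ⊛ gapProduct i j)) j
        ≈⟨ ∑<-distribˡ (linear j) (λ i → a i ⊛ gapProduct i j) j ⟩
      linear j ⊛ ∑< (λ i → a i ⊛ gapProduct i j) j
        ≈⟨ R.*-congˡ {linear j} (∑-gapProduct j) ⟩
      linear j ⊛ weightedSum j ∎)
    (R.trans (R.*-congˡ {a j} (gapProduct-adjacent j)) (R.*-identityʳ (a j)))
    where
    open ≋-Reasoning
    open PS-Solver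

  -- The right-hand side is the increment of `weightedSum` from j to j + 1, so the outer sum over j
  -- telescopes. The diagonal term supplies a_j, and all other terms share the factor - j x.
  innerSum : ∀ j → sumPS (map (λ i → const (sign (i ℕ.+ j)) ⊛ a i ⊛ β i j) (upTo (suc j)))
                 ≋ ⊖ (const (+ j) ⊛ X) ⊛ weightedSum j ⊕ a j
  innerSum j = R.trans (sumPS-upTo (λ i → const (sign (i ℕ.+ j)) ⊛ a i ⊛ β i j) (suc j)) (R.+-cong
    (begin
      ∑< (λ i → const (sign (i ℕ.+ j)) ⊛ a i ⊛ β i j) j
        ≈⟨ ∑<-cong j offDiagonal ⟩
      ∑< (λ i → ⊖ (const (+ j) ⊛ X) ⊛ (a i ⊛ gapProduct i j)) j
        ≈⟨ ∑<-distribˡ (⊖ (const (+ j) ⊛ X)) (λ i → a i ⊛ gapProduct i j) j ⟩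
      ⊖ (const (+ j) ⊛ X) ⊛ ∑< (λ i → a i ⊛ gapProduct i j) j
        ≈⟨ R.*-congˡ {⊖ (const (+ j) ⊛ X)} (∑-gapProduct j) ⟩
      ⊖ (const (+ j) ⊛ X) ⊛ weightedSum j ∎)
    (begin
      const (sign (j ℕ.+ j)) ⊛ a j ⊛ β j j ≈⟨ R.*-congˡ {const (sign (j ℕ.+ j)) ⊛ a j} (β-diagonal j) ⟩
      const (sign (j ℕ.+ j)) ⊛ a j ⊛ 1ₛ    ≡⟨ cong (λ s → const s ⊛ a j ⊛ 1ₛ) (sign-double j) ⟩
      1ₛ ⊛ a j ⊛ 1ₛ                        ≈⟨ solve 1 (λ a → con (+ 1) :* a :* con (+ 1) := a) R.refl (a j) ⟩
      a j                                  ∎))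
    where
    open ≋-Reasoning
    open PS-Solver
    offDiagonal : ∀ i → i < j → const (sign (i ℕ.+ j)) ⊛ a i ⊛ β i j ≋ ⊖ (const (+ j) ⊛ X) ⊛ (a i ⊛ gapProduct i j)
    offDiagonal i i<j = begin
      const (sign (i ℕ.+ j)) ⊛ a i ⊛ β i j
        ≈⟨ R.*-congˡ {const s ⊛ a i} (β-< i<j) ⟩
      const s ⊛ a i ⊛ (const (+ j) ⊛ X ⊛ q)
        ≈⟨ solve 5 (λ s a j x q → s :* a :* (j :* x :* q) := :- (j :* x) :* (a :* (:- s :* q)))
             R.refl (const s) (a i) (const (+ j)) X q ⟩
      ⊖ (const (+ j) ⊛ X) ⊛ (a i ⊛ (⊖ const s ⊛ q))
        ≈⟨ R.*-congˡ {⊖ (const (+ j) ⊛ X)} (R.*-congˡ {a i} (R.*-congʳ {q} (pointwise (const-neg s)))) ⟨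
      ⊖ (const (+ j) ⊛ X) ⊛ (a i ⊛ (const (ℤ.- s) ⊛ q))
        ≡⟨ cong (λ t → ⊖ (const (+ j) ⊛ X) ⊛ (a i ⊛ (const t ⊛ q))) (sign-suc (i ℕ.+ j)) ⟨
      ⊖ (const (+ j) ⊛ X) ⊛ (a i ⊛ gapProduct i j) ∎
      where
      s = sign (i ℕ.+ j)
      q = prodSX (suc i) (j ∸ suc i)

  signedSum≋weightedSum : ∀ K → signedSum K ≋ weightedSum K
  signedSum≋weightedSum K = R.trans (sumPS-upTo inner K) (go K)
    where
    open ≋-Reasoning
    open PS-Solver
    inner : ℕ → PS
    inner j = sumPS (map (λ i → const (sign (i ℕ.+ j)) ⊛ a i ⊛ β i j) (upTo (suc j)))
    go : ∀ K → ∑< inner K ≋ weightedSum K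
    go zero    = R.refl
    go (suc K) = begin
      ∑< inner K ⊕ inner K
        ≈⟨ R.+-cong (go K) (innerSum K) ⟩
      weightedSum K ⊕ (⊖ (const (+ K) ⊛ X) ⊛ weightedSum K ⊕ a K)
        ≈⟨ solve 4 (λ w k x a → w :+ (:- (k :* x) :* w :+ a) := (con (+ 1) :- k :* x) :* w :+ a)
             R.refl (weightedSum K) (const (+ K)) X (a K) ⟩
      linear K ⊛ weightedSum K ⊕ a K ∎

-- Numerator, denominator and the series H_m

linearProduct : ℕ → PS
linearProduct zero    = 1ₛ
linearProduct (suc m) = linear m ⊛ linearProduct m

T₁-weightedSum : ∀ k → T₁ k ≋ weightedSum (X ^ˢ_) (k ∸ 1)
T₁-weightedSum k = signedSum≋weightedSum (X ^ˢ_) (k ∸ 1)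

T₂-weightedSum : ∀ k → T₂ k ≋ weightedSum (λ i → const (+ i) ⊛ X) (k ∸ 1)
T₂-weightedSum k = begin
  sumPS (map (λ j → sumPS (map (term j) (upTo (suc j)))) (upTo (k ∸ 1)))
    ≈⟨ sumPS-map-cong (k ∸ 1) (λ j → sumPS-map-cong (suc j) (λ i →
         R.*-congʳ {β i j} (R.*-assoc (const (sign (i ℕ.+ j))) (const (+ i)) X))) ⟩
  signedSum (λ i → const (+ i) ⊛ X) (k ∸ 1)
    ≈⟨ signedSum≋weightedSum (λ i → const (+ i) ⊛ X) (k ∸ 1) ⟩
  weightedSum (λ i → const (+ i) ⊛ X) (k ∸ 1) ∎
  where
  open ≋-Reasoning
  term : ℕ → ℕ → PS
  term j i = const (sign (i ℕ.+ j)) ⊛ const (+ i) ⊛ X ⊛ β i j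

-- Since m x = 1 - (1 - m x), the weighted sum v with a_i = i x satisfies 1 - v_{m+1} = (1 - m x)(1
-- - v_m), so 1 - v is a product.
1⊝T₂ : ∀ k → 1ₛ ⊝ T₂ k ≋ linearProduct (k ∸ 1)
1⊝T₂ k = R.trans (R.+-congˡ {1ₛ} (R.-‿cong (T₂-weightedSum k))) (go (k ∸ 1))
  where
  open ≋-Reasoning
  open PS-Solver
  go : ∀ m → 1ₛ ⊝ weightedSum (λ i → const (+ i) ⊛ X) m ≋ linearProduct m
  go zero    = solve 0 (con (+ 1) :- con (+ 0) := con (+ 1)) R.refl
  go (suc m) = begin
    1ₛ ⊝ (linear m ⊛ v ⊕ const (+ m) ⊛ X)
      ≈⟨ solve 3 (λ m x v → con (+ 1) :- ((con (+ 1) :- m :* x) :* v :+ m :* x)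
                   := (con (+ 1) :- m :* x) :* (con (+ 1) :- v)) R.refl (const (+ m)) X v ⟩
    linear m ⊛ (1ₛ ⊝ v)
      ≈⟨ R.*-congˡ {linear m} (go m) ⟩
    linear m ⊛ linearProduct m ∎
    where v = weightedSum (λ i → const (+ i) ⊛ X) m

-- The equation for H_m says (1 - m x) H_m = 1 + x H_{m+1}. Multiplying by these linear factors one
-- after another pushes H_0 forward to H_m, and the constants 1 gather into the weighted sum of the
-- powers of x.
prefix-solution : ∀ c (H : ℕ → PS) →
  (∀ m → m < c → H m ≋ 1ₛ ⊕ X ⊛ (const (+ m) ⊛ H m ⊕ H (suc m))) →
  ∀ m → m ℕ.≤ c → linearProduct m ⊛ H 0 ≋ weightedSum (X ^ˢ_) m ⊕ X ^ˢ m ⊛ H m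
prefix-solution c H H-equation zero m≤c =
  solve 1 (λ h → con (+ 1) :* h := con (+ 0) :+ con (+ 1) :* h) R.refl (H 0)
  where open PS-Solver
prefix-solution c H H-equation (suc m) m<c = begin
  linear m ⊛ linearProduct m ⊛ H 0
    ≈⟨ R.*-assoc (linear m) (linearProduct m) (H 0) ⟩
  linear m ⊛ (linearProduct m ⊛ H 0)
    ≈⟨ R.*-congˡ {linear m} (prefix-solution c H H-equation m (ℕₚ.<⇒≤ m<c)) ⟩
  linear m ⊛ (v ⊕ X ^ˢ m ⊛ H m)
    ≈⟨ solve 5 (λ m x v q h → (con (+ 1) :- m :* x) :* (v :+ q :* h)
                  := (con (+ 1) :- m :* x) :* v :+ q :* (h :- m :* x :* h))
         R.refl (const (+ m)) X v (X ^ˢ m) (H m) ⟩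
  linear m ⊛ v ⊕ X ^ˢ m ⊛ (H m ⊝ const (+ m) ⊛ X ⊛ H m)
    ≈⟨ R.+-congˡ {linear m ⊛ v} (R.*-congˡ {X ^ˢ m} (R.+-congʳ (H-equation m m<c))) ⟩
  linear m ⊛ v ⊕ X ^ˢ m ⊛ (1ₛ ⊕ X ⊛ (const (+ m) ⊛ H m ⊕ H (suc m)) ⊝ const (+ m) ⊛ X ⊛ H m)
    ≈⟨ solve 6 (λ p m x q h h′ → p :+ q :* (con (+ 1) :+ x :* (m :* h :+ h′) :- m :* x :* h)
                  := p :+ q :+ x :* q :* h′)
         R.refl (linear m ⊛ v) (const (+ m)) X (X ^ˢ m) (H m) (H (suc m)) ⟩
  linear m ⊛ v ⊕ X ^ˢ m ⊕ X ^ˢ suc m ⊛ H (suc m) ∎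
  where
  open ≋-Reasoning
  open PS-Solver
  v = weightedSum (X ^ˢ_) m

-- Counting the words accepted by the automaton

≤⇒≤ᵇ-true : ∀ {m n} → m ≤ n → (m ≤ᵇ n) ≡ true
≤⇒≤ᵇ-true m≤n = Equivalence.to Boolₚ.T-≡ (ℕₚ.≤⇒≤ᵇ m≤n)

≰⇒≤ᵇ-false : ∀ {m n} → ¬ m ≤ n → (m ≤ᵇ n) ≡ false
≰⇒≤ᵇ-false {m} {n} m≰n with m ≤ᵇ n in eq
... | false = refl
... | true  = contradiction (ℕₚ.≤ᵇ⇒≤ m n (subst T (sym eq) tt)) m≰n

sumTo : (ℕ → ℕ) → ℕ → ℕ
sumTo f zero    = 0
sumTo f (suc n) = sumTo f n + f (suc n)

sumTo-cong : ∀ {f g} n → (∀ a → 1 ≤ a → a ≤ n → f a ≡ g a) → sumTo f n ≡ sumTo g n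
sumTo-cong zero    p = refl
sumTo-cong (suc n) p = cong₂ _+_ (sumTo-cong n (λ a 1≤a a≤n → p a 1≤a (ℕₚ.m≤n⇒m≤1+n a≤n)))
                                 (p (suc n) (s≤s z≤n) ℕₚ.≤-refl)

sumTo-const : ∀ x n → sumTo (λ _ → x) n ≡ n * x
sumTo-const x zero    = refl
sumTo-const x (suc n) = trans (cong (_+ x) (sumTo-const x n)) (ℕₚ.+-comm (n * x) x)

sumTo-+ : ∀ f m n → sumTo f (m + n) ≡ sumTo f m + sumTo (λ a → f (m + a)) n
sumTo-+ f m zero    = trans (cong (sumTo f) (ℕₚ.+-identityʳ m)) (sym (ℕₚ.+-identityʳ _))
sumTo-+ f m (suc n) = begin
  sumTo f (m + suc n)                                          ≡⟨ cong (sumTo f) (ℕₚ.+-suc m n) ⟩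
  sumTo f (m + n) + f (suc (m + n))                            ≡⟨ cong₂ _+_ (sumTo-+ f m n) (cong f (sym (ℕₚ.+-suc m n))) ⟩
  sumTo f m + sumTo (λ a → f (m + a)) n + f (m + suc n)        ≡⟨ ℕₚ.+-assoc (sumTo f m) _ _ ⟩
  sumTo f m + (sumTo (λ a → f (m + a)) n + f (m + suc n))      ∎
  where open ≡-Reasoning

sumTo-truncate : ∀ f m d → (∀ a → m < a → f a ≡ 0) → sumTo f (m + d) ≡ sumTo f m
sumTo-truncate f m d vanish = begin
  sumTo f (m + d)                             ≡⟨ sumTo-+ f m d ⟩
  sumTo f m + sumTo (λ a → f (m + a)) d       ≡⟨ cong (sumTo f m ℕ.+_) (sumTo-cong d (λ a 1≤a _ →
                                                   vanish (m + a) (ℕₚ.m<m+n m 1≤a))) ⟩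
  sumTo f m + sumTo (λ _ → 0) d               ≡⟨ cong (sumTo f m ℕ.+_) (trans (sumTo-const 0 d) (ℕₚ.*-zeroʳ d)) ⟩
  sumTo f m + 0                               ≡⟨ ℕₚ.+-identityʳ _ ⟩
  sumTo f m                                   ∎
  where open ≡-Reasoning

module _ {A : Set} where

  count : (A → Bool) → List A → ℕ
  count P xs = length (filterᵇ P xs)

  count-cong : ∀ {P Q : A → Bool} → (∀ x → P x ≡ Q x) → ∀ xs → count P xs ≡ count Q xs
  count-cong p []       = refl
  count-cong {P} {Q} p (x ∷ xs) with P x | Q x | p x
  ... | true  | true  | _ = cong suc (count-cong p xs)
  ... | false | false | _ = count-cong p xs

  count-false : ∀ (xs : List A) → count (λ _ → false) xs ≡ 0
  count-false []       = refl
  count-false (x ∷ xs) = count-false xs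

  count-++ : ∀ (P : A → Bool) xs ys → count P (xs ++ ys) ≡ count P xs + count P ys
  count-++ P xs ys = trans (cong length (filter-++ (T? ∘ P) xs ys)) (length-++ (filterᵇ P xs))

  count-filterᵇ : ∀ (P Q : A → Bool) xs → count P (filterᵇ Q xs) ≡ count (λ x → Q x ∧ P x) xs
  count-filterᵇ P Q []       = refl
  count-filterᵇ P Q (x ∷ xs) with Q x
  ... | false = count-filterᵇ P Q xs
  ... | true with P x
  ...   | true  = cong suc (count-filterᵇ P Q xs)
  ...   | false = count-filterᵇ P Q xs

count-map : ∀ {A B : Set} (P : B → Bool) (f : A → B) xs → count P (map f xs) ≡ count (P ∘ f) xs
count-map P f []       = refl
count-map P f (x ∷ xs) with P (f x)
... | true  = cong suc (count-map P f xs)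
... | false = count-map P f xs

count-concatMap : ∀ {A : Set} (P : A → Bool) (h : ℕ → List A) n →
  count P (concatMap h (map suc (upTo n))) ≡ sumTo (λ a → count P (h a)) n
count-concatMap P h zero    = refl
count-concatMap P h (suc n) = begin
  count P (concatMap h (map suc (upTo (suc n))))
    ≡⟨ cong (count P ∘ concatMap h ∘ map suc) (upTo-∷ʳ n) ⟨
  count P (concatMap h (map suc (upTo n ++ [ n ])))
    ≡⟨ cong (count P ∘ concatMap h) (map-++ suc (upTo n) [ n ]) ⟩
  count P (concatMap h (map suc (upTo n) ++ [ suc n ]))
    ≡⟨ cong (count P) (concatMap-++ h (map suc (upTo n)) [ suc n ]) ⟩
  count P (concatMap h (map suc (upTo n)) ++ (h (suc n) ++ []))
    ≡⟨ count-++ P (concatMap h (map suc (upTo n))) (h (suc n) ++ []) ⟩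
  count P (concatMap h (map suc (upTo n))) + count P (h (suc n) ++ [])
    ≡⟨ cong₂ _+_ (count-concatMap P h n) (cong (count P) (++-identityʳ (h (suc n)))) ⟩
  sumTo (λ a → count P (h a)) n + count P (h (suc n)) ∎
  where open ≡-Reasoning

-- The automaton and its transition counts

module Automaton (c : ℕ) where

  open ≡-Reasoning

  -- State after a prefix with maximum m: the letters U that may still be appended.
  -- Appending a forbids every b > a with b + c ≤ m, as a b would complete 1 2 ⋯ k 1 2 (k = c + 2).
  restrict : ℕ → ℕ → (ℕ → Bool) → (ℕ → Bool)
  restrict m a U b = U b ∧ not ((a <ᵇ b) ∧ (b + c ≤ᵇ m))

  accepts : ℕ → (ℕ → Bool) → List ℕ → Bool
  accepts m U []      = true
  accepts m U (a ∷ w) = U a ∧ accepts (m ⊔ a) (restrict m a U) w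

  restrict-small : ∀ {m a b} U → b ≤ a → restrict m a U b ≡ U b
  restrict-small {m} {a} {b} U b≤a with a <ᵇ b in eq
  ... | false = Boolₚ.∧-identityʳ (U b)
  ... | true  = contradiction (ℕₚ.<ᵇ⇒< a b (subst T (sym eq) tt)) (ℕₚ.≤⇒≯ b≤a)

  restrict-large : ∀ {m a b} U → m < b + c → restrict m a U b ≡ U b
  restrict-large {m} {a} {b} U m<b+c
    rewrite ≰⇒≤ᵇ-false (ℕₚ.<⇒≱ m<b+c) | Boolₚ.∧-zeroʳ (a <ᵇ b) = Boolₚ.∧-identityʳ (U b)

  restrict-critical : ∀ {m a b} U → a < b → b + c ≤ m → restrict m a U b ≡ false
  restrict-critical {m} {a} {b} U a<b b+c≤m
    rewrite ≤⇒≤ᵇ-true b+c≤m | ≤⇒≤ᵇ-true {suc a} {b} a<b = Boolₚ.∧-zeroʳ (U b)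

  accepts-cong : ∀ {U V} m → (∀ b → U b ≡ V b) → ∀ w → accepts m U w ≡ accepts m V w
  accepts-cong m p []      = refl
  accepts-cong m p (a ∷ w) = cong₂ _∧_ (p a) (accepts-cong (m ⊔ a) (λ b → cong (_∧ _) (p b)) w)

  module _ (M : ℕ) where

    -- Counts the accepted canonical continuations of length l. The alphabet size M stays fixed
    -- while l falls, since `partitions n` draws all letters from [n].
    N : ℕ → (ℕ → Bool) → ℕ → ℕ
    N m U l = count (λ w → isCanonical′ m w ∧ accepts m U w) (words l M)

    N-cong : ∀ {U V} m l → (∀ b → U b ≡ V b) → N m U l ≡ N m V l
    N-cong m l p = count-cong (λ w → cong (isCanonical′ m w ∧_) (accepts-cong m p w)) (words l M)

    successors : ℕ → (ℕ → Bool) → ℕ → ℕ → ℕ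
    successors m U l a = if U a then N (m ⊔ a) (restrict m a U) l else 0

    -- Canonicity excludes every first letter above m + 1; the hypothesis says that the alphabet
    -- reaches that far.
    N-suc : ∀ m U l d → suc m + d ≡ M → N m U (suc l) ≡ sumTo (successors m U l) (suc m)
    N-suc m U l d refl = begin
      N m U (suc l)
        ≡⟨ count-concatMap P (λ a → map (a ∷_) (words l M)) M ⟩
      sumTo byFirst (suc m + d)
        ≡⟨ sumTo-truncate byFirst (suc m) d tooLarge ⟩
      sumTo byFirst (suc m)
        ≡⟨ sumTo-cong (suc m) small ⟩
      sumTo (successors m U l) (suc m) ∎
      where
      P : List ℕ → Bool
      P w = isCanonical′ m w ∧ accepts m U w
      byFirst : ℕ → ℕ
      byFirst a = count P (map (a ∷_) (words l M))
      tooLarge : ∀ a → suc m < a → byFirst a ≡ 0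
      tooLarge a m<a = trans (count-map P (a ∷_) (words l M))
        (trans (count-cong rejected (words l M)) (count-false (words l M)))
        where
        rejected : ∀ w → P (a ∷ w) ≡ false
        rejected w rewrite ≰⇒≤ᵇ-false (ℕₚ.<⇒≱ m<a) | Boolₚ.∧-zeroʳ (1 ≤ᵇ a) = refl
      small : ∀ a → 1 ≤ a → a ≤ suc m → byFirst a ≡ successors m U l a
      small a 1≤a a≤1+m = trans (count-map P (a ∷_) (words l M)) step
        where
        step : count (P ∘ (a ∷_)) (words l M) ≡ successors m U l a
        step rewrite ≤⇒≤ᵇ-true 1≤a | ≤⇒≤ᵇ-true a≤1+m with U a
        ... | true  = refl
        ... | false = trans (count-cong (λ w → Boolₚ.∧-zeroʳ _) (words l M)) (count-false (words l M))

    successors-allowed : ∀ m U V l a → U a ≡ true → (∀ b → restrict m a U b ≡ V b) →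
      successors m U l a ≡ N (m ⊔ a) V l
    successors-allowed m U V l a Ua p rewrite Ua = N-cong (m ⊔ a) l p

  trueCount : (ℕ → Bool) → ℕ → ℕ
  trueCount U zero    = 0
  trueCount U (suc t) = if U (suc t) then suc (trueCount U t) else trueCount U t

  trueCount-cong : ∀ {U V} t → (∀ b → b ≤ t → U b ≡ V b) → trueCount U t ≡ trueCount V t
  trueCount-cong zero    p = refl
  trueCount-cong (suc t) p = cong₂ (λ e n → if e then suc n else n) (p (suc t) ℕₚ.≤-refl)
    (trueCount-cong t (λ b b≤t → p b (ℕₚ.m≤n⇒m≤1+n b≤t)))

  -- All letters above a in this interval are critical and become forbidden, while those up to a
  -- keep their status.
  trueCount-restrict : ∀ U m a e → (a + e) + c ≤ m → trueCount (restrict m a U) (a + e) ≡ trueCount U a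
  trueCount-restrict U m a zero    le rewrite ℕₚ.+-identityʳ a = trueCount-cong a (λ b → restrict-small U)
  trueCount-restrict U m a (suc e) le rewrite ℕₚ.+-suc a e
    | restrict-critical {m} {a} {suc (a + e)} U (s≤s (ℕₚ.m≤m+n a e)) le =
      trueCount-restrict U m a e (ℕₚ.<⇒≤ le)

  -- At the r-th allowed letter a, `trueCount U a` is r, so the sum over allowed letters can be
  -- indexed by r.
  sumTo-trueCount : ∀ U g t → sumTo (λ a → if U a then g (trueCount U a) else 0) t ≡ sumTo g (trueCount U t)
  sumTo-trueCount U g zero    = refl
  sumTo-trueCount U g (suc t) with U (suc t)
  ... | true  = cong (_+ g (suc (trueCount U t))) (sumTo-trueCount U g t)
  ... | false = trans (ℕₚ.+-identityʳ _) (sumTo-trueCount U g t)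

  -- Continuations of length l when the maximum is at least c and u critical letters are still allowed.
  critical : ℕ → ℕ → ℕ
  critical zero    u = 1
  critical (suc l) u = c * critical l u + sumTo (critical l) u + critical l (suc u)

  -- With maximum c + t the letters 1, ..., t are critical, the c letters t + 1, ..., t + c are
  -- free, and c + t + 1 is the new maximum. Only critical letters ever get forbidden, so the
  -- letters above t stay allowed throughout. The bound on M leaves room for a new maximum at each
  -- of the l steps.
  N-critical : ∀ M l t U → c + t + l ≤ M → (∀ b → t < b → U b ≡ true) → N M (c + t) U l ≡ critical l (trueCount U t)
  N-critical M zero    t U le allowed = refl
  N-critical M (suc l) t U le allowed = begin
    N M (c + t) U (suc l)
      ≡⟨ N-suc M (c + t) U l (M ∸ suc (c + t)) (ℕₚ.m+[n∸m]≡n (ℕₚ.≤-trans (ℕₚ.m≤m+n (suc (c + t)) l) le′)) ⟩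
    sumTo f (c + t) + f (suc (c + t))
      ≡⟨ cong₂ _+_ (trans (cong (sumTo f) (ℕₚ.+-comm c t)) (sumTo-+ f t c)) newLetter ⟩
    sumTo f t + sumTo (λ a → f (t + a)) c + critical l (suc u)
      ≡⟨ cong (_+ critical l (suc u)) (cong₂ _+_
           (trans (sumTo-cong t criticalLetter) (sumTo-trueCount U (critical l) t))
           (trans (sumTo-cong c freeLetter) (sumTo-const (critical l u) c))) ⟩
    sumTo (critical l) u + c * critical l u + critical l (suc u)
      ≡⟨ cong (_+ critical l (suc u)) (ℕₚ.+-comm (sumTo (critical l) u) (c * critical l u)) ⟩
    c * critical l u + sumTo (critical l) u + critical l (suc u) ∎
    where
    u = trueCount U t
    f = successors M (c + t) U l
    le′ : suc (c + t) + l ≤ M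
    le′ = subst (_≤ M) (ℕₚ.+-suc (c + t) l) le
    smaller : c + t + l ≤ M
    smaller = ℕₚ.<⇒≤ le′
    beyond : ∀ {b} → t < b → c + t < b + c
    beyond {b} t<b = subst (c + t <_) (ℕₚ.+-comm c b) (ℕₚ.+-monoʳ-< c t<b)
    unchanged : ∀ a → t ≤ a → ∀ b → restrict (c + t) a U b ≡ U b
    unchanged a t≤a b with b ℕ.≤? a
    ... | yes b≤a = restrict-small U b≤a
    ... | no  b≰a = restrict-large U (beyond (ℕₚ.≤-<-trans t≤a (ℕₚ.≰⇒> b≰a)))
    -- The new maximum makes t + 1 critical while it is still allowed, so u rises by one.
    newLetter : f (suc (c + t)) ≡ critical l (suc u)
    newLetter = begin
      f (suc (c + t))
        ≡⟨ successors-allowed M (c + t) U U l (suc (c + t)) (allowed _ (s≤s (ℕₚ.m≤n+m t c)))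
             (unchanged (suc (c + t)) (ℕₚ.m≤n⇒m≤1+n (ℕₚ.m≤n+m t c))) ⟩
      N M (c + t ⊔ suc (c + t)) U l
        ≡⟨ cong (λ m → N M m U l) (trans (ℕₚ.m≤n⇒m⊔n≡n (ℕₚ.n≤1+n (c + t))) (sym (ℕₚ.+-suc c t))) ⟩
      N M (c + suc t) U l
        ≡⟨ N-critical M l (suc t) U (subst (λ e → e + l ≤ M) (sym (ℕₚ.+-suc c t)) le′)
             (λ b lt → allowed b (ℕₚ.<⇒≤ lt)) ⟩
      critical l (trueCount U (suc t))
        ≡⟨ cong (λ e → critical l (if e then suc u else u)) (allowed (suc t) ℕₚ.≤-refl) ⟩
      critical l (suc u) ∎
    freeLetter : ∀ a → 1 ≤ a → a ≤ c → f (t + a) ≡ critical l u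
    freeLetter a 1≤a a≤c = begin
      f (t + a)
        ≡⟨ successors-allowed M (c + t) U U l (t + a) (allowed _ (ℕₚ.m<m+n t 1≤a))
             (unchanged (t + a) (ℕₚ.m≤m+n t a)) ⟩
      N M (c + t ⊔ (t + a)) U l
        ≡⟨ cong (λ m → N M m U l) (ℕₚ.m≥n⇒m⊔n≡m
             (subst (t + a ≤_) (ℕₚ.+-comm t c) (ℕₚ.+-monoʳ-≤ t a≤c))) ⟩
      N M (c + t) U l
        ≡⟨ N-critical M l t U smaller allowed ⟩
      critical l u ∎
    criticalLetter : ∀ a → 1 ≤ a → a ≤ t → f a ≡ (if U a then critical l (trueCount U a) else 0)
    criticalLetter a 1≤a a≤t = cong (λ e → if U a then e else 0) (begin
      N M (c + t ⊔ a) (restrict (c + t) a U) l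
        ≡⟨ cong (λ m → N M m (restrict (c + t) a U) l) (ℕₚ.m≥n⇒m⊔n≡m (ℕₚ.≤-trans a≤t (ℕₚ.m≤n+m t c))) ⟩
      N M (c + t) (restrict (c + t) a U) l
        ≡⟨ N-critical M l t (restrict (c + t) a U) smaller
             (λ b t<b → trans (restrict-large U (beyond t<b)) (allowed b t<b)) ⟩
      critical l (trueCount (restrict (c + t) a U) t)
        ≡⟨ cong (critical l) (subst (λ s → trueCount (restrict (c + t) a U) s ≡ trueCount U a) (ℕₚ.m+[n∸m]≡n a≤t)
             (trueCount-restrict U (c + t) a (t ∸ a)
               (subst (λ s → s + c ≤ c + t) (sym (ℕₚ.m+[n∸m]≡n a≤t)) (ℕₚ.≤-reflexive (ℕₚ.+-comm t c))))) ⟩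
      critical l (trueCount U a) ∎)

  -- Continuations of length l when the maximum m = c ∸ e is at most c, so that no letter is critical.
  initial : ℕ → ℕ → ℕ → ℕ
  initial zero    m l       = critical l 0
  initial (suc e) m zero    = 1
  initial (suc e) m (suc l) = m * initial (suc e) m l + initial e (suc m) l

  -- While m < c no letter b has b + c ≤ m, so nothing gets forbidden and each of the m old letters
  -- leads back to the same state. At m = c the count passes to `N-critical` with t = 0.
  N-initial : ∀ M e l m U → m + e ≡ c → m + l ≤ M → (∀ b → U b ≡ true) → N M m U l ≡ initial e m l
  N-initial M zero l m U m+e≡c le allowed = begin
    N M m U l         ≡⟨ cong (λ m → N M m U l) m≡c+0 ⟩
    N M (c + 0) U l   ≡⟨ N-critical M l 0 U (subst (λ m → m + l ≤ M) m≡c+0 le) (λ b _ → allowed b) ⟩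
    critical l 0      ∎
    where
    m≡c+0 : m ≡ c + 0
    m≡c+0 = trans (sym (ℕₚ.+-identityʳ m)) (trans m+e≡c (sym (ℕₚ.+-identityʳ c)))
  N-initial M (suc e) zero    m U m+e≡c le allowed = refl
  N-initial M (suc e) (suc l) m U m+e≡c le allowed = begin
    N M m U (suc l)
      ≡⟨ N-suc M m U l (M ∸ suc m) (ℕₚ.m+[n∸m]≡n (ℕₚ.≤-trans (ℕₚ.m≤m+n (suc m) l) le′)) ⟩
    sumTo f m + f (suc m)
      ≡⟨ cong₂ _+_ (trans (sumTo-cong m oldLetter) (sumTo-const (initial (suc e) m l) m)) newLetter ⟩
    m * initial (suc e) m l + initial e (suc m) l ∎
    where
    f = successors M m U l
    le′ : suc m + l ≤ M
    le′ = subst (_≤ M) (ℕₚ.+-suc m l) le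
    m<c : m < c
    m<c = subst (m <_) m+e≡c (ℕₚ.m<m+n m (s≤s z≤n))
    unchanged : ∀ a b → restrict m a U b ≡ U b
    unchanged a b = restrict-large U (ℕₚ.<-≤-trans m<c (ℕₚ.m≤n+m c b))
    oldLetter : ∀ a → 1 ≤ a → a ≤ m → f a ≡ initial (suc e) m l
    oldLetter a _ a≤m = begin
      f a             ≡⟨ successors-allowed M m U U l a (allowed a) (unchanged a) ⟩
      N M (m ⊔ a) U l ≡⟨ cong (λ m → N M m U l) (ℕₚ.m≥n⇒m⊔n≡m a≤m) ⟩
      N M m U l       ≡⟨ N-initial M (suc e) l m U m+e≡c (ℕₚ.<⇒≤ le′) allowed ⟩
      initial (suc e) m l ∎
    newLetter : f (suc m) ≡ initial e (suc m) l
    newLetter = begin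
      f (suc m)           ≡⟨ successors-allowed M m U U l (suc m) (allowed (suc m)) (unchanged (suc m)) ⟩
      N M (m ⊔ suc m) U l ≡⟨ cong (λ m → N M m U l) (ℕₚ.m≤n⇒m⊔n≡n (ℕₚ.n≤1+n m)) ⟩
      N M (suc m) U l     ≡⟨ N-initial M e l (suc m) U (trans (sym (ℕₚ.+-suc m e)) m+e≡c) le′ allowed ⟩
      initial e (suc m) l ∎

-- The automaton recognises pattern avoidance

module _ {A : Set} where

  -- Ranks in `reduce` are lengths of duplicate-free lists, so this lets them be compared through
  -- inclusion of letter sets.
  Unique-⊆⇒length-≤ : ∀ {xs ys : List A} → Unique xs → (∀ {x} → x ∈ xs → x ∈ ys) → length xs ≤ length ys
  Unique-⊆⇒length-≤ []            xs⊆ys = z≤n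
  Unique-⊆⇒length-≤ {x ∷ xs} (x∉xs ∷ xs!) xs⊆ys with ∈-∃++ (xs⊆ys (here refl))
  ... | us , vs , refl = begin
    suc (length xs)                   ≤⟨ s≤s (Unique-⊆⇒length-≤ xs! xs⊆us++vs) ⟩
    suc (length (us ++ vs))           ≡⟨ cong suc (length-++ us) ⟩
    suc (length us + length vs)       ≡⟨ ℕₚ.+-suc (length us) (length vs) ⟨
    length us + suc (length vs)       ≡⟨ length-++ us ⟨
    length (us ++ x ∷ vs)             ∎
    where
    open ℕₚ.≤-Reasoning
    xs⊆us++vs : ∀ {y} → y ∈ xs → y ∈ us ++ vs
    xs⊆us++vs y∈xs with ∈-++⁻ us (xs⊆ys (there y∈xs))
    ... | inj₁ y∈us          = ∈-++⁺ˡ y∈us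
    ... | inj₂ (here y≡x)    = contradiction (sym y≡x) (All.lookup x∉xs y∈xs)
    ... | inj₂ (there y∈vs)  = ∈-++⁺ʳ us y∈vs

-- Reduced forms and ranks

lettersBelow : List ℕ → ℕ → List ℕ
lettersBelow w a = deduplicate ℕ._≟_ (filterᵇ (λ b → suc b ≤ᵇ a) w)

-- `reduce w` is `map (rank w) w` by definition.
rank : List ℕ → ℕ → ℕ
rank w a = suc (length (lettersBelow w a))

∈-lettersBelow⁺ : ∀ {w a x} → x ∈ w → x < a → x ∈ lettersBelow w a
∈-lettersBelow⁺ {w} {a} x∈w x<a = ∈-deduplicate⁺ ℕ._≟_ (∈-filter⁺ (T? ∘ (λ b → suc b ≤ᵇ a)) x∈w (ℕₚ.≤⇒≤ᵇ x<a))

∈-lettersBelow⁻ : ∀ w a {x} → x ∈ lettersBelow w a → x ∈ w × x < a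
∈-lettersBelow⁻ w a {x} x∈ with ∈-filter⁻ (T? ∘ (λ b → suc b ≤ᵇ a)) {xs = w} (∈-deduplicate⁻ ℕ._≟_ (filterᵇ (λ b → suc b ≤ᵇ a) w) x∈)
... | x∈w , x<a = x∈w , ℕₚ.≤ᵇ⇒≤ (suc x) a x<a

lettersBelow-! : ∀ w a → Unique (lettersBelow w a)
lettersBelow-! w a = deduplicate-! (filterᵇ (λ b → suc b ≤ᵇ a) w)

rank-mono-≤ : ∀ w {a b} → a ≤ b → rank w a ≤ rank w b
rank-mono-≤ w {a} {b} a≤b = s≤s (Unique-⊆⇒length-≤ (lettersBelow-! w a)
  λ x∈ → let x∈w , x<a = ∈-lettersBelow⁻ w a x∈ in ∈-lettersBelow⁺ x∈w (ℕₚ.<-≤-trans x<a a≤b))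

-- As a occurs in w, it joins the letters below b without being among those below a.
rank-mono-< : ∀ {w a b} → a ∈ w → a < b → rank w a < rank w b
rank-mono-< {w} {a} {b} a∈w a<b = s≤s (Unique-⊆⇒length-≤
  (All.tabulate (λ x∈ a≡x → ℕₚ.<-irrefl (sym a≡x) (proj₂ (∈-lettersBelow⁻ w a x∈))) ∷ lettersBelow-! w a)
  λ { (here refl) → ∈-lettersBelow⁺ a∈w a<b
    ; (there x∈)  → let x∈w , x<a = ∈-lettersBelow⁻ w a x∈ in ∈-lettersBelow⁺ x∈w (ℕₚ.<-trans x<a a<b) })

rank-cancel-< : ∀ w {a b} → rank w a < rank w b → a < b
rank-cancel-< w ra<rb = ℕₚ.≰⇒> λ b≤a → ℕₚ.<⇒≱ ra<rb (rank-mono-≤ w b≤a)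

rank-injective : ∀ {w a b} → a ∈ w → b ∈ w → rank w a ≡ rank w b → a ≡ b
rank-injective {w} {a} {b} a∈w b∈w eq with ℕₚ.<-cmp a b
... | tri< a<b _ _ = contradiction (rank-mono-< a∈w a<b) (ℕₚ.<-irrefl eq)
... | tri≈ _ a≡b _ = a≡b
... | tri> _ _ b<a = contradiction (rank-mono-< b∈w b<a) (ℕₚ.<-irrefl (sym eq))

module _ (f : ℕ → ℕ) (f-mono : ∀ {a b} → a < b → f a < f b) where

  mono⇒cancel-< : ∀ {a b} → f a < f b → a < b
  mono⇒cancel-< {a} {b} fa<fb with ℕₚ.<-cmp a b
  ... | tri< a<b _ _  = a<b
  ... | tri≈ _ refl _ = contradiction fa<fb (ℕₚ.<-irrefl refl)
  ... | tri> _ _ b<a  = contradiction fa<fb (ℕₚ.<⇒≯ (f-mono b<a))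

  mono⇒injective : ∀ {a b} → f a ≡ f b → a ≡ b
  mono⇒injective {a} {b} eq with ℕₚ.<-cmp a b
  ... | tri< a<b _ _ = contradiction (f-mono a<b) (ℕₚ.<-irrefl eq)
  ... | tri≈ _ a≡b _ = a≡b
  ... | tri> _ _ b<a = contradiction (f-mono b<a) (ℕₚ.<-irrefl (sym eq))

  rank-map : ∀ w a → rank (map f w) (f a) ≡ rank w a
  rank-map w a = cong suc (trans (ℕₚ.≤-antisym
    (Unique-⊆⇒length-≤ (lettersBelow-! (map f w) (f a)) below⊆)
    (Unique-⊆⇒length-≤ (Unique-map⁺ mono⇒injective (lettersBelow-! w a)) ⊆below))
    (length-map f (lettersBelow w a)))
    where
    below⊆ : ∀ {x} → x ∈ lettersBelow (map f w) (f a) → x ∈ map f (lettersBelow w a)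
    below⊆ x∈ with ∈-lettersBelow⁻ (map f w) (f a) x∈
    ... | x∈fw , x<fa with ∈-map⁻ f x∈fw
    ...   | y , y∈w , refl = ∈-map⁺ f (∈-lettersBelow⁺ y∈w (mono⇒cancel-< x<fa))
    ⊆below : ∀ {x} → x ∈ map f (lettersBelow w a) → x ∈ lettersBelow (map f w) (f a)
    ⊆below x∈ with ∈-map⁻ f x∈
    ... | y , y∈ , refl = let y∈w , y<a = ∈-lettersBelow⁻ w a y∈ in ∈-lettersBelow⁺ (∈-map⁺ f y∈w) (f-mono y<a)

  reduce-map : ∀ w → reduce (map f w) ≡ reduce w
  reduce-map w = trans (sym (map-∘ w)) (map-cong-local (All.tabulate λ {a} _ → rank-map w a))

-- Avoidance as absence of a subsequence

sublists-sound : ∀ w {s} → s ∈ sublists w → s ⊆ w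
sublists-sound []      (here refl) = []
sublists-sound (a ∷ w) s∈ with ∈-++⁻ (map (a ∷_) (sublists w)) s∈
... | inj₂ s∈w = a ∷ʳ sublists-sound w s∈w
... | inj₁ s∈aw with ∈-map⁻ (a ∷_) s∈aw
...   | s′ , s′∈w , refl = refl ∷ sublists-sound w s′∈w

sublists-complete : ∀ {s w} → s ⊆ w → s ∈ sublists w
sublists-complete []                  = here refl
sublists-complete {w = a ∷ w} (.a ∷ʳ σ)   = ∈-++⁺ʳ (map (a ∷_) (sublists w)) (sublists-complete σ)
sublists-complete {w = a ∷ w} (refl ∷ σ) = ∈-++⁺ˡ (∈-map⁺ (a ∷_) (sublists-complete σ))

avoids-true : ∀ π τ → (∀ {s} → s ⊆ π → reduce s ≢ reduce τ) → avoids π τ ≡ true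
avoids-true π τ none = go (sublists π) (λ s∈ → none (sublists-sound π s∈))
  where
  go : ∀ ss → (∀ {s} → s ∈ ss → reduce s ≢ reduce τ) →
       foldr (λ s r → not (reduce s ==ᴸ reduce τ) ∧ r) true ss ≡ true
  go []       none = refl
  go (s ∷ ss) none with ≡-dec ℕ._≟_ (reduce s) (reduce τ)
  ... | yes eq = contradiction eq (none (here refl))
  ... | no  _  = go ss (none ∘ there)

avoids-false : ∀ π τ {s} → s ⊆ π → reduce s ≡ reduce τ → avoids π τ ≡ false
avoids-false π τ {s} s⊆π eq = go (sublists π) (sublists-complete s⊆π)
  where
  go : ∀ ss → s ∈ ss → foldr (λ s r → not (reduce s ==ᴸ reduce τ) ∧ r) true ss ≡ false
  go (s′ ∷ ss) s∈ with ≡-dec ℕ._≟_ (reduce s′) (reduce τ) | s∈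
  ... | yes _  | _          = refl
  ... | no neq | here refl  = contradiction eq neq
  ... | no _   | there s∈ss = go ss s∈ss

range : ℕ → ℕ → List ℕ
range s zero    = []
range s (suc n) = s ∷ range (suc s) n

applyUpTo-range : ∀ f s n → (∀ i → f i ≡ s + i) → applyUpTo f n ≡ range s n
applyUpTo-range f s zero    p = refl
applyUpTo-range f s (suc n) p = cong₂ _∷_ (trans (p 0) (ℕₚ.+-identityʳ s))
  (applyUpTo-range (f ∘ suc) (suc s) n (λ i → trans (p (suc i)) (ℕₚ.+-suc s i)))

range-∷ʳ : ∀ s n → range s (suc n) ≡ range s n ++ [ s + n ]
range-∷ʳ s zero    = cong [_] (sym (ℕₚ.+-identityʳ s))
range-∷ʳ s (suc n) = cong (s ∷_) (trans (range-∷ʳ (suc s) n) (cong (λ e → range (suc s) n ++ [ e ]) (sym (ℕₚ.+-suc s n))))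

range-⊆ : ∀ {b k s} n → s ≤ b → b + k ≤ s + n → range b k ⊆ range s n
range-⊆ {b} {zero}  {s} zero    s≤b le = []
range-⊆ {b} {suc k} {s} zero    s≤b le = contradiction
  (ℕₚ.≤-trans le (ℕₚ.≤-trans (ℕₚ.≤-reflexive (ℕₚ.+-identityʳ s)) s≤b)) (ℕₚ.m+1+n≰m b)
range-⊆ {b} {k}     {s} (suc n) s≤b le with ℕₚ.m≤n⇒m<n∨m≡n s≤b
... | inj₁ s<b  = s ∷ʳ range-⊆ n s<b (subst (b + k ≤_) (ℕₚ.+-suc s n) le)
... | inj₂ refl with k
...   | zero   = s ∷ʳ range-⊆ {suc s} {0} n ℕₚ.≤-refl (ℕₚ.+-monoʳ-≤ (suc s) z≤n)
...   | suc k′ = refl ∷ range-⊆ n ℕₚ.≤-refl (subst₂ _≤_ (ℕₚ.+-suc s k′) (ℕₚ.+-suc s n) le)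

-- A canonical prefix with maximum m has 1, 2, ..., m as a subsequence; the first k letters of a
-- pattern copy are extracted from it in this way.
∷-range-⊆ : ∀ {a b k s} n → s ≤ a → a < b → b + k ≤ s + n → a ∷ range b k ⊆ range s n
∷-range-⊆ {a} {b} {k} {s} zero s≤a a<b le = contradiction
  (ℕₚ.≤-trans (ℕₚ.m≤m+n b k) (ℕₚ.≤-trans le (ℕₚ.≤-reflexive (ℕₚ.+-identityʳ s))))
  (ℕₚ.<⇒≱ (ℕₚ.≤-<-trans s≤a a<b))
∷-range-⊆ {a} {b} {k} {s} (suc n) s≤a a<b le with ℕₚ.m≤n⇒m<n∨m≡n s≤a
... | inj₁ s<a  = s ∷ʳ ∷-range-⊆ n s<a a<b (subst (b + k ≤_) (ℕₚ.+-suc s n) le)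
... | inj₂ refl = refl ∷ range-⊆ n a<b (subst (b + k ≤_) (ℕₚ.+-suc s n) le)

∧-true : ∀ {x y} → x ∧ y ≡ true → x ≡ true × y ≡ true
∧-true {true} {true} _ = refl , refl

≤ᵇ-true⇒≤ : ∀ {m n} → (m ≤ᵇ n) ≡ true → m ≤ n
≤ᵇ-true⇒≤ {m} {n} eq = ℕₚ.≤ᵇ⇒≤ m n (subst T (sym eq) _)

-- Rejection by the automaton as occurrence of the pattern

module Correctness (c : ℕ) where

  open Automaton c

  τ : List ℕ
  τ = pattern-k12 (suc (suc c))

  pattern-range : τ ≡ range 1 (suc (suc c)) ++ 1 ∷ 2 ∷ []
  pattern-range = cong (_++ 1 ∷ 2 ∷ []) (trans (map-applyUpTo id suc (suc (suc c)))
    (applyUpTo-range suc 1 (suc (suc c)) (λ _ → refl)))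

  -- A copy of 1 2 ⋯ k 1 2 short of its final 2: a plays 1, and b, ..., b + c play 2, ..., k.
  beforeLast : ℕ → ℕ → List ℕ
  beforeLast a b = a ∷ range b (suc c) ++ a ∷ []

  occurrence : ℕ → ℕ → List ℕ
  occurrence a b = beforeLast a b ++ [ b ]

  module _ {a b : ℕ} (1≤a : 1 ≤ a) (a<b : a < b) where

    -- Carries the pattern onto `occurrence a b`. The value at 0, a letter absent from the pattern,
    -- keeps the map increasing on all of ℕ, as `reduce-map` requires.
    relabel : ℕ → ℕ
    relabel zero          = 0
    relabel (suc zero)    = a
    relabel (suc (suc i)) = b + i

    relabel-mono : ∀ {i j} → i < j → relabel i < relabel j
    relabel-mono {zero}        {suc zero}    _ = 1≤a
    relabel-mono {zero}        {suc (suc j)} _ = ℕₚ.≤-trans (ℕₚ.<-trans 1≤a a<b) (ℕₚ.m≤m+n b j)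
    relabel-mono {suc zero}    {suc (suc j)} _ = ℕₚ.≤-trans a<b (ℕₚ.m≤m+n b j)
    relabel-mono {suc zero}    {suc zero}    (s≤s ())
    relabel-mono {suc (suc i)} {suc (suc j)} (s≤s (s≤s i<j)) = ℕₚ.+-monoʳ-< b i<j
    relabel-mono {suc (suc i)} {suc zero}    (s≤s ())

    map-relabel : map relabel τ ≡ occurrence a b
    map-relabel = begin
      map relabel (map suc (upTo (suc (suc c))) ++ 1 ∷ 2 ∷ [])
        ≡⟨ map-++ relabel (map suc (upTo (suc (suc c)))) (1 ∷ 2 ∷ []) ⟩
      map relabel (map suc (upTo (suc (suc c)))) ++ a ∷ b + 0 ∷ []
        ≡⟨ cong₂ (λ us v → us ++ a ∷ v ∷ [])
             (trans (sym (map-∘ (upTo (suc (suc c))))) (map-applyUpTo id (relabel ∘ suc) (suc (suc c))))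
             (ℕₚ.+-identityʳ b) ⟩
      a ∷ applyUpTo (b ℕ.+_) (suc c) ++ a ∷ b ∷ []
        ≡⟨ cong (λ us → a ∷ us ++ a ∷ b ∷ []) (applyUpTo-range (b ℕ.+_) b (suc c) (λ _ → refl)) ⟩
      a ∷ range b (suc c) ++ a ∷ b ∷ []
        ≡⟨ ++-assoc (a ∷ range b (suc c)) (a ∷ []) (b ∷ []) ⟨
      occurrence a b ∎
      where open ≡-Reasoning

    reduce-occurrence : reduce (occurrence a b) ≡ reduce τ
    reduce-occurrence = trans (cong reduce (sym map-relabel)) (reduce-map relabel relabel-mono τ)

  -- With b appended, such a prefix p contains a copy of the pattern.
  Blocked : ℕ → List ℕ → Set
  Blocked b p = ∃ λ a → 1 ≤ a × a < b × beforeLast a b ⊆ p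

  -- Two invariants hold of the prefix p read so far: it contains 1, ..., m in order, and every
  -- forbidden letter would complete a copy of the pattern. The first rejected letter then does
  -- complete one.
  rejected⇒occurrence : ∀ w p m U → isCanonical′ m w ≡ true → range 1 m ⊆ p →
    (∀ b → U b ≡ false → Blocked b p) → accepts m U w ≡ false →
    ∃₂ λ a b → 1 ≤ a × a < b × occurrence a b ⊆ p ++ w
  rejected⇒occurrence (x ∷ w) p m U can initial⊆p blocked rej with ∧-true {1 ≤ᵇ x} can
  ... | 1≤x , can′ with ∧-true {x ≤ᵇ suc m} can′
  ...   | x≤1+m , can″ with U x in Ux
  ...     | false = let a , 1≤a , a<x , σ = blocked x Ux in
                    a , x , 1≤a , a<x , ++⁺ σ (refl ∷ minimum w)
  ...     | true  with rejected⇒occurrence w (p ++ [ x ]) (m ⊔ x) (restrict m x U) can″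
                         initial⊆px blocked′ rej
    where
    initial⊆px : range 1 (m ⊔ x) ⊆ p ++ [ x ]
    initial⊆px with ℕₚ.m≤n⇒m<n∨m≡n (≤ᵇ-true⇒≤ {x} x≤1+m)
    ... | inj₁ (s≤s x≤m) rewrite ℕₚ.m≥n⇒m⊔n≡m x≤m = ++⁺ʳ (x ∷ []) initial⊆p
    ... | inj₂ refl rewrite ℕₚ.m≤n⇒m⊔n≡n (ℕₚ.n≤1+n m) | range-∷ʳ 1 m = ++⁺ initial⊆p ⊆-refl
    blocked′ : ∀ b → restrict m x U b ≡ false → Blocked b (p ++ [ x ])
    blocked′ b eq with U b in Ub
    ... | false = let a , 1≤a , a<b , σ = blocked b Ub in a , 1≤a , a<b , ++⁺ʳ (x ∷ []) σ
    ... | true with x <ᵇ b in x<ᵇb | b + c ≤ᵇ m in b+c≤ᵇm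
    -- Here x itself forbids b. As b + c ≤ m, the prefix contains x, b, ..., b + c in order, and the
    -- x just read is the second 1 of the copy.
    ...   | true | true = x , ≤ᵇ-true⇒≤ {1} 1≤x , x<b
          , ++⁺ (⊆-trans (∷-range-⊆ m (≤ᵇ-true⇒≤ {1} 1≤x) x<b
                   (subst (_≤ suc m) (sym (ℕₚ.+-suc b c)) (s≤s (≤ᵇ-true⇒≤ {b + c} b+c≤ᵇm)))) initial⊆p) ⊆-refl
      where
      x<b : x < b
      x<b = ℕₚ.<ᵇ⇒< x b (subst T (sym x<ᵇb) _)
  ...       | a , b , 1≤a , a<b , σ = a , b , 1≤a , a<b , subst (occurrence a b ⊆_) (∷ʳ-++ p x w) σ

  -- `restrict` never allows a forbidden letter again.
  blocked⇒rejected : ∀ {b w} m U → U b ≡ false → b ∈ w → accepts m U w ≡ false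
  blocked⇒rejected m U Ub (here refl) rewrite Ub = refl
  blocked⇒rejected {b} {x ∷ w} m U Ub (there b∈w) =
    trans (cong (U x ∧_) (blocked⇒rejected (m ⊔ x) (restrict m x U) (cong (_∧ _) Ub) b∈w)) (Boolₚ.∧-zeroʳ (U x))

  pair⇒rejected : ∀ {a b w} m U → a < b → b + c ≤ m → a ∷ b ∷ [] ⊆ w → accepts m U w ≡ false
  pair⇒rejected m U a<b le (x ∷ʳ σ) =
    trans (cong (U x ∧_) (pair⇒rejected (m ⊔ x) (restrict m x U) a<b (ℕₚ.m≤n⇒m≤n⊔o x le) σ)) (Boolₚ.∧-zeroʳ (U x))
  pair⇒rejected {a} m U a<b le (refl ∷ σ) =
    trans (cong (U a ∧_) (blocked⇒rejected (m ⊔ a) (restrict m a U) (restrict-critical U a<b le) (to∈ σ))) (Boolₚ.∧-zeroʳ (U a))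

  foldl-⊔-mono : ∀ {m n} s → m ≤ n → foldl _⊔_ m s ≤ foldl _⊔_ n s
  foldl-⊔-mono []      m≤n = m≤n
  foldl-⊔-mono (x ∷ s) m≤n = foldl-⊔-mono s (ℕₚ.⊔-monoˡ-≤ x m≤n)

  ≤-foldl-⊔ : ∀ m s → m ≤ foldl _⊔_ m s
  ≤-foldl-⊔ m []      = ℕₚ.≤-refl
  ≤-foldl-⊔ m (x ∷ s) = ℕₚ.≤-trans (ℕₚ.m≤m⊔n m x) (≤-foldl-⊔ (m ⊔ x) s)

  ∈⇒≤-foldl-⊔ : ∀ {e s} m → e ∈ s → e ≤ foldl _⊔_ m s
  ∈⇒≤-foldl-⊔ {s = x ∷ s} m (here refl) = ℕₚ.≤-trans (ℕₚ.m≤n⊔m m x) (≤-foldl-⊔ (m ⊔ x) s)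
  ∈⇒≤-foldl-⊔ {s = x ∷ s} m (there e∈s) = ∈⇒≤-foldl-⊔ (m ⊔ x) e∈s

  -- `foldl _⊔_ m s` is the maximum after reading s. Letters of w skipped by the subsequence can
  -- only raise it, so it is at least b + c once the final pair a b is reached.
  occurrence⇒rejected : ∀ {a b} s {w} m U → a < b → b + c ≤ foldl _⊔_ m s → s ++ a ∷ b ∷ [] ⊆ w → accepts m U w ≡ false
  occurrence⇒rejected []      m U a<b le σ = pair⇒rejected m U a<b le σ
  occurrence⇒rejected (y ∷ s) m U a<b le (x ∷ʳ σ) =
    trans (cong (U x ∧_) (occurrence⇒rejected (y ∷ s) (m ⊔ x) (restrict m x U) a<b
            (ℕₚ.≤-trans le (foldl-⊔-mono (y ∷ s) (ℕₚ.m≤m⊔n m x))) σ)) (Boolₚ.∧-zeroʳ (U x))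
  occurrence⇒rejected (y ∷ s) m U a<b le (refl ∷ σ) =
    trans (cong (U y ∧_) (occurrence⇒rejected s (m ⊔ y) (restrict m y U) a<b le σ)) (Boolₚ.∧-zeroʳ (U y))

  module _ (s : List ℕ) where

    -- The letters of s in the places of 2 3 ⋯ k strictly increase, so the last is ≥ the first + k − 2.
    climb : ∀ n j e t → rank s e ≡ rank τ j → (∀ {x} → x ∈ range j (suc n) → x ∈ τ) →
      map (rank s) t ≡ map (rank τ) (range (suc j) n ++ 1 ∷ 2 ∷ []) →
      ∃₂ λ t′ x → ∃₂ λ y e′ →
        t ≡ t′ ++ x ∷ y ∷ [] × rank s x ≡ rank τ 1 × rank s y ≡ rank τ 2 × e′ ∈ e ∷ t′ × e + n ≤ e′
    climb zero j e (x ∷ y ∷ []) re _ eq with ∷-injective eq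
    ... | rx , eq′ with ∷-injective eq′
    ...   | ry , _ = [] , x , y , e , refl , rx , ry , here refl , ℕₚ.≤-reflexive (ℕₚ.+-identityʳ e)
    climb (suc n) j e (z ∷ t) re ⊆τ eq with ∷-injective eq
    ... | rz , eq′ with climb n (suc j) z t rz (⊆τ ∘ there) eq′
    ...   | t′ , x , y , e′ , refl , rx , ry , e′∈ , le =
            z ∷ t′ , x , y , e′ , refl , rx , ry , there e′∈
            , ℕₚ.≤-trans (ℕₚ.≤-trans (ℕₚ.≤-reflexive (ℕₚ.+-suc e n)) (ℕₚ.+-monoˡ-≤ n e<z)) le
      where
      -- The ranks of e and z in s are those of j and j + 1 in the pattern, which differ because j
      -- occurs there.
      e<z : e < z
      e<z = rank-cancel-< s (subst₂ _<_ (sym re) (sym rz) (rank-mono-< (⊆τ (here refl)) (ℕₚ.n<1+n j)))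

  1∈τ : 1 ∈ τ
  1∈τ = here refl

  -- Equal reduced forms give equal ranks place by place. The letters y₀ and y both play 2 and hence
  -- coincide, x plays 1 and so x < y, and `climb` finds a letter at least y + c ahead of the pair x
  -- y.
  reduce≡⇒rejected : ∀ {s w} U → s ⊆ w → reduce s ≡ reduce τ → accepts 0 U w ≡ false
  reduce≡⇒rejected {s} {w} U s⊆w eq
    with s | s⊆w | trans eq (cong (map (rank τ)) pattern-range)
  ... | x₀ ∷ y₀ ∷ t | s⊆w | eq with ∷-injective eq
  ...   | _ , eq′ with ∷-injective eq′
  -- There are c steps from the place of 2 to that of k = c + 2.
  ...     | ry₀ , eq″ with climb (x₀ ∷ y₀ ∷ t) c 2 y₀ t ry₀
                             (λ {x} x∈ → subst (x ∈_) (sym pattern-range) (there (∈-++⁺ˡ x∈))) eq″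
  ...       | t′ , x , y , e , refl , rx , ry , e∈ , le =
    occurrence⇒rejected (x₀ ∷ y₀ ∷ t′) 0 U x<y
      (subst (λ z → z + c ≤ _) (sym y≡y₀) (ℕₚ.≤-trans le (∈⇒≤-foldl-⊔ 0 (there {x = x₀} e∈)))) s⊆w
    where
    s′ = x₀ ∷ y₀ ∷ t′ ++ x ∷ y ∷ []
    x<y : x < y
    x<y = rank-cancel-< s′ (subst₂ _<_ (sym rx) (sym ry) (rank-mono-< {b = 2} 1∈τ (s≤s (s≤s z≤n))))
    y≡y₀ : y ≡ y₀
    y≡y₀ = rank-injective {s′} (there (there (∈-++⁺ʳ t′ (there (here refl))))) (there (here refl)) (trans ry (sym ry₀))

  avoids≡accepts : ∀ π → isCanonical π ≡ true → avoids π τ ≡ accepts 0 (λ _ → true) π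
  avoids≡accepts π can with accepts 0 (λ _ → true) π in acc
  ... | true  = avoids-true π τ λ s⊆π eq → contradiction
                  (trans (sym acc) (reduce≡⇒rejected (λ _ → true) s⊆π eq)) λ ()
  ... | false = let a , b , 1≤a , a<b , σ = rejected⇒occurrence π [] 0 (λ _ → true) can [] (λ _ ()) acc in
                avoids-false π τ σ (reduce-occurrence 1≤a a<b)

  countP≡initial : ∀ n → countP (suc (suc c)) n ≡ initial c 0 n
  countP≡initial n = begin
    count (λ π → avoids π τ) (partitions n)
      ≡⟨ count-filterᵇ (λ π → avoids π τ) isCanonical (words n n) ⟩
    count (λ π → isCanonical π ∧ avoids π τ) (words n n)
      ≡⟨ count-cong canonicalOnly (words n n) ⟩
    N n 0 (λ _ → true) n
      ≡⟨ N-initial n c n 0 (λ _ → true) refl ℕₚ.≤-refl (λ _ → refl) ⟩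
    initial c 0 n ∎
    where
    open ≡-Reasoning
    canonicalOnly : ∀ π → isCanonical π ∧ avoids π τ ≡ isCanonical π ∧ accepts 0 (λ _ → true) π
    canonicalOnly π with isCanonical π in can
    ... | true  = avoids≡accepts π can
    ... | false = refl

-- The generating function

ogf-recurrence : ∀ a (f r : ℕ → ℕ) → f 0 ≡ 1 → (∀ l → f (suc l) ≡ a ℕ.* f l ℕ.+ r l) →
  ogf f ≋ 1ₛ ⊕ X ⊛ (const (+ a) ⊛ ogf f ⊕ ogf r)
ogf-recurrence a f r f0 f-suc = pointwise λ
  { zero    → trans (cong +_ f0) (sym (cong (ℤ._+_ (+ 1)) (X-⊛-zero (const (+ a) ⊛ ogf f ⊕ ogf r))))
  ; (suc l) → begin
      + f (suc l)                                              ≡⟨ cong +_ (f-suc l) ⟩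
      + (a ℕ.* f l ℕ.+ r l)                                    ≡⟨ ℤₚ.pos-+ (a ℕ.* f l) (r l) ⟩
      + (a ℕ.* f l) ℤ.+ + r l                                  ≡⟨ cong (ℤ._+ + r l) (trans (ℤₚ.pos-* a (f l)) (sym (const-⊛ (+ a) (ogf f) l))) ⟩
      (const (+ a) ⊛ ogf f ⊕ ogf r) l                          ≡⟨ X-⊛-suc (const (+ a) ⊛ ogf f ⊕ ogf r) l ⟨
      (X ⊛ (const (+ a) ⊛ ogf f ⊕ ogf r)) (suc l)              ≡⟨ ℤₚ.+-identityˡ _ ⟨
      (1ₛ ⊕ X ⊛ (const (+ a) ⊛ ogf f ⊕ ogf r)) (suc l)         ∎ }
  where open ≡-Reasoning

module _ (c : ℕ) where

  open Automaton c

  H : ℕ → PS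
  H m = ogf (initial (c ∸ m) m)

  H-equation : ∀ m → m < c → H m ≋ 1ₛ ⊕ X ⊛ (const (+ m) ⊛ H m ⊕ H (suc m))
  -- Exposes c ∸ m as a successor, so that `initial` unfolds.
  H-equation m m<c rewrite ℕₚ.+-∸-assoc 1 m<c =
    ogf-recurrence m (initial (suc (c ∸ suc m)) m) (initial (c ∸ suc m) (suc m)) refl (λ _ → refl)

module _ (c : ℕ) (y : PS) (y-quadratic : linear c ⊛ y ≋ 1ₛ ⊕ linear c ⊛ X ⊛ y ⊛ y) where

  open Automaton c

  -- Both families obey the same recurrence, which determines coefficient l + 1 for u from the
  -- coefficients l for indices up to u + 1; hence the induction on l with u general.
  critical≡G : ∀ l u → + critical l u ≡ G c y u l
  ∑critical≡ΣG : ∀ l u → + sumTo (critical l) u ≡ ΣG c y u l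

  critical≡G zero u = sym (trans (at (G-equation c y y-quadratic u) 0)
    (cong (ℤ._+_ (+ 1)) (X-⊛-zero (const (+ c) ⊛ G c y u ⊕ ΣG c y u ⊕ G c y (suc u)))))
  critical≡G (suc l) u = begin
    + (c ℕ.* critical l u ℕ.+ sumTo (critical l) u ℕ.+ critical l (suc u))
      ≡⟨ trans (ℤₚ.pos-+ (c ℕ.* critical l u ℕ.+ sumTo (critical l) u) (critical l (suc u)))
           (cong (ℤ._+ + critical l (suc u)) (trans (ℤₚ.pos-+ (c ℕ.* critical l u) (sumTo (critical l) u))
             (cong (ℤ._+ + sumTo (critical l) u) (ℤₚ.pos-* c (critical l u))))) ⟩
    + c ℤ.* + critical l u ℤ.+ + sumTo (critical l) u ℤ.+ + critical l (suc u)
      ≡⟨ cong₂ ℤ._+_ (cong₂ ℤ._+_ (trans (cong (ℤ._*_ (+ c)) (critical≡G l u)) (sym (const-⊛ (+ c) (Gc u) l)))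
           (∑critical≡ΣG l u)) (critical≡G l (suc u)) ⟩
    rest l
      ≡⟨ X-⊛-suc rest l ⟨
    (X ⊛ rest) (suc l)
      ≡⟨ ℤₚ.+-identityˡ _ ⟨
    (1ₛ ⊕ X ⊛ rest) (suc l)
      ≡⟨ at (G-equation c y y-quadratic u) (suc l) ⟨
    Gc u (suc l) ∎
    where
    open ≡-Reasoning
    Gc = G c y
    rest = const (+ c) ⊛ Gc u ⊕ ΣG c y u ⊕ Gc (suc u)
  ∑critical≡ΣG l zero    = sym (const-0 l)
  ∑critical≡ΣG l (suc u) = trans (ℤₚ.pos-+ (sumTo (critical l) u) (critical l (suc u)))
    (cong₂ ℤ._+_ (∑critical≡ΣG l u) (critical≡G l (suc u)))

  H-last : H c c ≋ y
  H-last rewrite ℕₚ.n∸n≡0 c = R.trans (pointwise λ l → critical≡G l 0) (R.*-identityʳ y)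

-- Fractions are multiplied out: S is the square root, w the inverse of 1 - x y, and the denominator
-- of the generating function stands as a factor on the left.
theorem1 : (k : ℕ) → 2 ≤ k →
    (S y w : PS) →
    S 0 ≡ + 1 →
    S ⊛ S ≈ (const (+ 1) ⊝ const (+ k) ⊛ X) ^ˢ 2 ⊝ const (+ 4) ⊛ X ^ˢ 2 →
    const (+ 2) ⊛ X ⊛ (const (+ 1) ⊝ const (+ (k ∸ 2)) ⊛ X) ⊛ y
    ≈ const (+ 1) ⊝ const (+ (k ∸ 2)) ⊛ X ⊝ S →
    w ⊛ (const (+ 1) ⊝ X ⊛ y) ≈ const (+ 1) →
    ogf (countP k) ⊛ (const (+ 1) ⊝ T₂ k) ≈ X ^ˢ (k ∸ 1) ⊛ y ⊛ w ⊕ T₁ k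
theorem1 (suc (suc c)) (s≤s (s≤s z≤n)) S y w _ S² S-via-y w-inverse = at (begin
  ogf (countP k) ⊛ (1ₛ ⊝ T₂ k)
    ≈⟨ R.*-cong (pointwise λ n → cong +_ (Correctness.countP≡initial c n)) (1⊝T₂ k) ⟩
  H₀ ⊛ (p ⊛ linearProduct c)
    ≈⟨ solve 3 (λ h p q → h :* (p :* q) := p :* (q :* h)) R.refl H₀ p (linearProduct c) ⟩
  p ⊛ (linearProduct c ⊛ H₀)
    ≈⟨ R.*-congˡ {p} (prefix-solution c (H c) (H-equation c) c ℕₚ.≤-refl) ⟩
  p ⊛ (v ⊕ X ^ˢ c ⊛ H c c)
    ≈⟨ R.*-congˡ {p} (R.+-congˡ {v} (R.*-congˡ {X ^ˢ c} (H-last c y y-quad))) ⟩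
  p ⊛ (v ⊕ X ^ˢ c ⊛ y)
    ≈⟨ solve 4 (λ p v q y → p :* (v :+ q :* y) := q :* (p :* y) :+ p :* v) R.refl p v (X ^ˢ c) y ⟩
  X ^ˢ c ⊛ (p ⊛ y) ⊕ p ⊛ v
    -- Of the factor 1 + p x y², the second term gives x^{k-1} y (p y), where p y is w; the term 1
    -- leaves x^c, which extends the weighted sum of `T₁` from c to c + 1 = k - 1.
    ≈⟨ R.+-congʳ {p ⊛ v} (R.*-congˡ {X ^ˢ c} y-quad) ⟩
  X ^ˢ c ⊛ (1ₛ ⊕ p ⊛ X ⊛ y ⊛ y) ⊕ p ⊛ v
    ≈⟨ solve 5 (λ p x v q y → q :* (con (+ 1) :+ p :* x :* y :* y) :+ p :* v
                  := x :* q :* y :* (p :* y) :+ (p :* v :+ q)) R.refl p X v (X ^ˢ c) y ⟩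
  X ^ˢ suc c ⊛ y ⊛ (p ⊛ y) ⊕ (p ⊛ v ⊕ X ^ˢ c)
    ≈⟨ R.+-cong (R.*-congˡ {X ^ˢ suc c ⊛ y} (inverse-1⊝Xy c y y-quad w (pointwise w-inverse))) (T₁-weightedSum k) ⟨
  X ^ˢ suc c ⊛ y ⊛ w ⊕ T₁ k ∎)
  where
  open ≋-Reasoning
  open PS-Solver
  k = suc (suc c)
  p = linear c
  v = weightedSum (X ^ˢ_) c
  y-quad : p ⊛ y ≋ 1ₛ ⊕ p ⊛ X ⊛ y ⊛ y
  y-quad = y-quadratic c S y (pointwise S²) (pointwise S-via-y)
  H₀ = H c 0
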